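{- Let $\varepsilon\in[0,1]$. If $\varepsilon>0$, then the FPARS $(\Lambda_{\mathsf{WN}},\mathsf{P}_\varepsilon)$ is positive almost-surely terminating (PAST), i.e. $\mathsf{Steps}_{\mathsf{P}_\varepsilon}(M)<+\infty$ for every weakly normalising $\lambda$-term $M$.
   Context: $\lambda$-terms: $\Lambda$ is the set of untyped $\lambda$-terms $M,N ::= x \mid MN \mid \lambda x.M$ ($x$ in a countably infinite set of variables), modulo $\alpha$-equivalence. A $\beta$-redex is a term $(\lambda x.M)N$; its contractum is $M\{N/x\}$ (capture-avoiding substitution). $M\to_\beta N$ means that $N$ is obtained from $M$ by replacing one occurrence of a redex in $M$ (anywhere in the term) by its contractum. A term is in normal form if it has no $\beta$-reduct, reducible otherwise; it is weakly normalising if some $\beta$-reduction sequence from it reaches a normal form. $\Lambda_{\mathsf{WN}}$ is the set of weakly normalising terms (closed under $\beta$-reduction). The leftmost-outermost ($\mathsf{LO}$) redex of a reducible term is the leftmost among its redexes, and the rightmost-innermost ($\mathsf{RI}$) redex is the rightmost among its redexes, the position of a redex being measured by its beginning symbol in the written term. $\mathsf{LO}(M)$, $\mathsf{RI}(M)$ denote the terms obtained from $M$ by firing these redexes. For $\varepsilon\in[0,1]$, the randomised strategy $\mathsf{P}_\varepsilon$ assigns to each reducible term $M$ the probability distribution on terms that fires the $\mathsf{LO}$-redex with probability $\varepsilon$ and the $\mathsf{RI}$-redex with probability $1-\varepsilon$, i.e. $\mathsf{P}_\varepsilon(M)=\varepsilon\,\delta_{\mathsf{LO}(M)}+(1-\varepsilon)\,\delta_{\mathsf{RI}(M)}$;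 it is undefined on normal forms. Put $\mathbb{P}(M\to N)=\mathsf{P}_\varepsilon(M)(N)$ if $M$ is reducible, $0$ if $M$ is a normal form. The computation starting from $M$ is the sequence $(\rho_i)_{i\in\mathbb{N}}$ with $\rho_0$ the Dirac distribution at $M$ and $\rho_{i+1}(N)=\sum_{L}\rho_i(L)\,\mathbb{P}(L\to N)$. Write $|\rho|=\sum_N\rho(N)$ and $\mathsf{Steps}_{\mathsf{P}_\varepsilon}(M)=\sum_{i=1}^\infty|\rho_i|\in[0,+\infty]$ (the average number of steps to normal form). -}

module Defs where

open import Data.Nat.Base as ℕ using (ℕ; zero; suc)
import Data.Nat.Properties as ℕₚ
open import Data.Product using (∃; _×_; _,_; proj₁; proj₂)

-- Real numbers as Cauchy sequences of rationals.  The operations act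
-- termwise; two sequences denote the same real when each is ≤ the other.

module Real where

  open import Data.List.Base using (List; []; _∷_)
  open import Data.Rational as ℚ using (ℚ; 0ℚ; 1ℚ; ½; ∣_∣)
  open import Data.Rational.Properties as ℚₚ using ()
  open import Data.Rational.Solver using (module +-*-Solver)
  open import Relation.Binary.PropositionalEquality
    using (_≡_; refl; sym; trans; cong; cong₂; subst)
  open +-*-Solver using (solve; _:+_; _:*_; _:-_; :-_; _:=_)

  IsCauchy : (ℕ → ℚ) → Set
  IsCauchy x = ∀ δ → 0ℚ ℚ.< δ →
    ∃ λ N → ∀ m n → N ℕ.≤ m → N ℕ.≤ n → ∣ x m ℚ.- x n ∣ ℚ.≤ δ

  record ℝ : Set where
    constructor mkℝ
    field
      seq    : ℕ → ℚ
      cauchy : IsCauchy seq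

  open ℝ public

  private
    halves : ∀ δ → ½ ℚ.* δ ℚ.+ ½ ℚ.* δ ≡ δ
    halves δ = trans (sym (ℚₚ.*-distribʳ-+ δ ½ ½)) (ℚₚ.*-identityˡ δ)

    pos*pos : ∀ p q → 0ℚ ℚ.< p → 0ℚ ℚ.< q → 0ℚ ℚ.< p ℚ.* q
    pos*pos p q p>0 q>0 =
      ℚₚ.positive⁻¹ (p ℚ.* q) {{ℚₚ.pos*pos⇒pos p {{ℚ.positive p>0}} q {{ℚ.positive q>0}}}}

    half-pos : ∀ {δ} → 0ℚ ℚ.< δ → 0ℚ ℚ.< ½ ℚ.* δ
    half-pos {δ} = pos*pos ½ δ (ℚₚ.positive⁻¹ ½)

    shrink : ∀ {δ C} → 0ℚ ℚ.< δ → 0ℚ ℚ.< C →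
             ∃ λ η → 0ℚ ℚ.< η × C ℚ.* η ≡ δ
    shrink {δ} {C} δ>0 C>0 = η , pos*pos (ℚ.1/ C) δ (ℚₚ.positive⁻¹ (ℚ.1/ C) {{ℚₚ.1/pos⇒pos C}}) δ>0 , eq
      where
      instance
        C-pos : ℚ.Positive C
        C-pos = ℚ.positive C>0
        C-nz : ℚ.NonZero C
        C-nz = ℚₚ.pos⇒nonZero C
      η = (ℚ.1/ C) ℚ.* δ
      eq : C ℚ.* η ≡ δ
      eq = trans (sym (ℚₚ.*-assoc C (ℚ.1/ C) δ))
                 (trans (cong (ℚ._* δ) (ℚₚ.*-inverseʳ C)) (ℚₚ.*-identityˡ δ))

    bounded : ∀ {x} → IsCauchy x →
              ∃ λ B → 0ℚ ℚ.< B × ∃ λ N → ∀ n → N ℕ.≤ n → ∣ x n ∣ ℚ.≤ B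
    bounded {x} cx with cx 1ℚ (ℚₚ.positive⁻¹ 1ℚ)
    ... | N , close = 1ℚ ℚ.+ ∣ x N ∣ , B>0 , N , bound
      where
      open ℚₚ.≤-Reasoning
      B>0 : 0ℚ ℚ.< 1ℚ ℚ.+ ∣ x N ∣
      B>0 = ℚₚ.+-mono-<-≤ (ℚₚ.positive⁻¹ 1ℚ) (ℚₚ.0≤∣p∣ (x N))
      bound : ∀ n → N ℕ.≤ n → ∣ x n ∣ ℚ.≤ 1ℚ ℚ.+ ∣ x N ∣
      bound n N≤n = begin
        ∣ x n ∣                       ≡⟨ cong ∣_∣ (solve 2 (λ a b → a := (a :- b) :+ b) refl (x n) (x N)) ⟩
        ∣ (x n ℚ.- x N) ℚ.+ x N ∣     ≤⟨ ℚₚ.∣p+q∣≤∣p∣+∣q∣ (x n ℚ.- x N) (x N) ⟩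
        ∣ x n ℚ.- x N ∣ ℚ.+ ∣ x N ∣   ≤⟨ ℚₚ.+-monoˡ-≤ ∣ x N ∣ (close n N N≤n ℕₚ.≤-refl) ⟩
        1ℚ ℚ.+ ∣ x N ∣                ∎

    mono-*-∣∣ : ∀ p q {r s} → ∣ p ∣ ℚ.≤ r → ∣ q ∣ ℚ.≤ s → 0ℚ ℚ.≤ r →
                ∣ p ℚ.* q ∣ ℚ.≤ r ℚ.* s
    mono-*-∣∣ p q {r} {s} p≤r q≤s r≥0 = begin
      ∣ p ℚ.* q ∣      ≡⟨ ℚₚ.∣p*q∣≡∣p∣*∣q∣ p q ⟩
      ∣ p ∣ ℚ.* ∣ q ∣  ≤⟨ ℚₚ.*-monoʳ-≤-nonNeg ∣ q ∣ {{ℚ.nonNegative (ℚₚ.0≤∣p∣ q)}} p≤r ⟩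
      r ℚ.* ∣ q ∣      ≤⟨ ℚₚ.*-monoˡ-≤-nonNeg r {{ℚ.nonNegative r≥0}} q≤s ⟩
      r ℚ.* s          ∎
      where open ℚₚ.≤-Reasoning

    const-cauchy : ∀ q → IsCauchy (λ _ → q)
    const-cauchy q δ δ>0 =
      0 , λ _ _ _ _ → subst (λ z → ∣ z ∣ ℚ.≤ δ) (sym (ℚₚ.+-inverseʳ q)) (ℚₚ.<⇒≤ δ>0)

    +-cauchy : ∀ x y → IsCauchy x → IsCauchy y → IsCauchy (λ n → x n ℚ.+ y n)
    +-cauchy x y cx cy δ δ>0
      with cx (½ ℚ.* δ) (half-pos δ>0) | cy (½ ℚ.* δ) (half-pos δ>0)
    ... | Nx , closeˣ | Ny , closeʸ = Nx ℕ.⊔ Ny , λ m n p q → begin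
      ∣ (x m ℚ.+ y m) ℚ.- (x n ℚ.+ y n) ∣
        ≡⟨ cong ∣_∣ (solve 4 (λ a b c d → (a :+ b) :- (c :+ d) := (a :- c) :+ (b :- d))
                       refl (x m) (y m) (x n) (y n)) ⟩
      ∣ (x m ℚ.- x n) ℚ.+ (y m ℚ.- y n) ∣
        ≤⟨ ℚₚ.∣p+q∣≤∣p∣+∣q∣ (x m ℚ.- x n) (y m ℚ.- y n) ⟩
      ∣ x m ℚ.- x n ∣ ℚ.+ ∣ y m ℚ.- y n ∣
        ≤⟨ ℚₚ.+-mono-≤ (closeˣ m n (ℕₚ.m⊔n≤o⇒m≤o Nx Ny p) (ℕₚ.m⊔n≤o⇒m≤o Nx Ny q))
                       (closeʸ m n (ℕₚ.m⊔n≤o⇒n≤o Nx Ny p) (ℕₚ.m⊔n≤o⇒n≤o Nx Ny q)) ⟩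
      ½ ℚ.* δ ℚ.+ ½ ℚ.* δ
        ≡⟨ halves δ ⟩
      δ ∎
      where open ℚₚ.≤-Reasoning

    neg-cauchy : ∀ x → IsCauchy x → IsCauchy (λ n → ℚ.- x n)
    neg-cauchy x cx δ δ>0 with cx δ δ>0
    ... | N , close = N , λ m n p q → begin
      ∣ (ℚ.- x m) ℚ.- (ℚ.- x n) ∣  ≡⟨ cong ∣_∣ (solve 2 (λ a b → (:- a) :- (:- b) := :- (a :- b)) refl (x m) (x n)) ⟩
      ∣ ℚ.- (x m ℚ.- x n) ∣        ≡⟨ ℚₚ.∣-p∣≡∣p∣ (x m ℚ.- x n) ⟩
      ∣ x m ℚ.- x n ∣              ≤⟨ close m n p q ⟩
      δ ∎
      where open ℚₚ.≤-Reasoning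

    above₄ : ∀ a b c d → ∃ λ N → ∀ k → N ℕ.≤ k →
             a ℕ.≤ k × b ℕ.≤ k × c ℕ.≤ k × d ℕ.≤ k
    above₄ a b c d = (a ℕ.⊔ b) ℕ.⊔ (c ℕ.⊔ d) , λ k p →
      let ab = ℕₚ.m⊔n≤o⇒m≤o (a ℕ.⊔ b) (c ℕ.⊔ d) p
          cd = ℕₚ.m⊔n≤o⇒n≤o (a ℕ.⊔ b) (c ℕ.⊔ d) p
      in ℕₚ.m⊔n≤o⇒m≤o a b ab , ℕₚ.m⊔n≤o⇒n≤o a b ab ,
         ℕₚ.m⊔n≤o⇒m≤o c d cd , ℕₚ.m⊔n≤o⇒n≤o c d cd

    product-close : ∀ a b c d {B C η θ δ} →
      ∣ a ∣ ℚ.≤ B → ∣ d ∣ ℚ.≤ C → ∣ a ℚ.- c ∣ ℚ.≤ η → ∣ b ℚ.- d ∣ ℚ.≤ θ →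
      0ℚ ℚ.≤ B → 0ℚ ℚ.≤ C → B ℚ.* θ ≡ ½ ℚ.* δ → C ℚ.* η ≡ ½ ℚ.* δ →
      ∣ a ℚ.* b ℚ.- c ℚ.* d ∣ ℚ.≤ δ
    product-close a b c d {B} {C} {η} {θ} {δ} a≤B d≤C ac≤η bd≤θ B≥0 C≥0 Bθ Cη = begin
      ∣ a ℚ.* b ℚ.- c ℚ.* d ∣
        ≡⟨ cong ∣_∣ (solve 4 (λ a b c d → a :* b :- c :* d := a :* (b :- d) :+ d :* (a :- c))
                       refl a b c d) ⟩
      ∣ a ℚ.* (b ℚ.- d) ℚ.+ d ℚ.* (a ℚ.- c) ∣
        ≤⟨ ℚₚ.∣p+q∣≤∣p∣+∣q∣ (a ℚ.* (b ℚ.- d)) (d ℚ.* (a ℚ.- c)) ⟩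
      ∣ a ℚ.* (b ℚ.- d) ∣ ℚ.+ ∣ d ℚ.* (a ℚ.- c) ∣
        ≤⟨ ℚₚ.+-mono-≤ (mono-*-∣∣ a (b ℚ.- d) a≤B bd≤θ B≥0)
                       (mono-*-∣∣ d (a ℚ.- c) d≤C ac≤η C≥0) ⟩
      B ℚ.* θ ℚ.+ C ℚ.* η
        ≡⟨ cong₂ ℚ._+_ Bθ Cη ⟩
      ½ ℚ.* δ ℚ.+ ½ ℚ.* δ
        ≡⟨ halves δ ⟩
      δ ∎
      where open ℚₚ.≤-Reasoning

    *-cauchy : ∀ x y → IsCauchy x → IsCauchy y → IsCauchy (λ n → x n ℚ.* y n)
    *-cauchy x y cx cy δ δ>0 =
      let B , B>0 , N₁ , boundˣ = bounded cx
          C , C>0 , N₂ , boundʸ = bounded cy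
          η , η>0 , Cη = shrink (half-pos δ>0) C>0
          θ , θ>0 , Bθ = shrink (half-pos δ>0) B>0
          N₃ , closeˣ = cx η η>0
          N₄ , closeʸ = cy θ θ>0
          N , above = above₄ N₁ N₂ N₃ N₄
      in N , λ m n p q →
         let m₁ , _  , m₃ , m₄ = above m p
             _  , n₂ , n₃ , n₄ = above n q
         in product-close (x m) (y m) (x n) (y n)
           (boundˣ m m₁) (boundʸ n n₂) (closeˣ m n m₃ n₃) (closeʸ m n m₄ n₄)
           (ℚₚ.<⇒≤ B>0) (ℚₚ.<⇒≤ C>0) Bθ Cη

  infix  4 _≤_ _<_
  infixl 6 _+_ _-_
  infixl 7 _*_
  infix  8 -_

  0ℝ 1ℝ : ℝ
  0ℝ = mkℝ (λ _ → 0ℚ) (const-cauchy 0ℚ)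
  1ℝ = mkℝ (λ _ → 1ℚ) (const-cauchy 1ℚ)

  -_ : ℝ → ℝ
  - x = mkℝ (λ n → ℚ.- seq x n) (neg-cauchy (seq x) (cauchy x))

  _+_ _*_ _-_ : ℝ → ℝ → ℝ
  x + y = mkℝ (λ n → seq x n ℚ.+ seq y n) (+-cauchy (seq x) (seq y) (cauchy x) (cauchy y))
  x * y = mkℝ (λ n → seq x n ℚ.* seq y n) (*-cauchy (seq x) (seq y) (cauchy x) (cauchy y))
  x - y = x + (- y)

  _≤_ _<_ : ℝ → ℝ → Set
  x ≤ y = ∀ δ → 0ℚ ℚ.< δ → ∃ λ N → ∀ n → N ℕ.≤ n → seq x n ℚ.≤ seq y n ℚ.+ δ
  x < y = ∃ λ δ → 0ℚ ℚ.< δ × ∃ λ N → ∀ n → N ℕ.≤ n → seq x n ℚ.+ δ ℚ.≤ seq y n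

  ∑ : {A : Set} → List A → (A → ℝ) → ℝ
  ∑ []       f = 0ℝ
  ∑ (a ∷ as) f = f a + ∑ as f

  partialSum : (ℕ → ℝ) → ℕ → ℝ
  partialSum a zero    = 0ℝ
  partialSum a (suc n) = partialSum a n + a n

  ConvergesTo : (ℕ → ℝ) → ℝ → Set
  ConvergesTo a s = ∀ δ → 0ℝ < δ →
    ∃ λ N → ∀ n → N ℕ.≤ n → a n ≤ s + δ × s ≤ a n + δ

  HasSum : (ℕ → ℝ) → ℝ → Set
  HasSum a s = ConvergesTo (partialSum a) s

-- λ-terms modulo α, with de Bruijn indices.  The infinitely many indices
-- not bound in a term are its free variables.

module Lambda where

  open import Data.List.Base using (List; []; _∷_; _++_; map)
  open import Data.List.Membership.Propositional using (_∈_)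
  open import Data.List.Membership.Propositional.Properties
    using (∈-++⁺ˡ; ∈-++⁺ʳ; ∈-map⁺)
  open import Data.List.Relation.Unary.Any using (here)
  open import Data.List.Extrema ℕₚ.≤-totalOrder using (argmin; argmax)
  open import Relation.Binary.Construct.Closure.ReflexiveTransitive using (Star)
  open import Relation.Binary.Definitions using (DecidableEquality)
  open import Relation.Binary.PropositionalEquality using (_≡_; refl; cong; cong₂)
  open import Relation.Nullary using (¬_; yes; no)
  open import Relation.Nullary.Decidable using (map′; _×-dec_)

  infixl 7 _·_
  infix  6 ƛ_
  infix  4 _→β_ _↠β_

  data Λ : Set where
    var : ℕ → Λ
    ƛ_  : Λ → Λ
    _·_ : Λ → Λ → Λ

  _≟_ : DecidableEquality Λ
  var x ≟ var y       = map′ (cong var) (λ { refl → refl }) (x ℕₚ.≟ y)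
  var _ ≟ (ƛ _)       = no λ ()
  var _ ≟ (_ · _)     = no λ ()
  (ƛ _) ≟ var _       = no λ ()
  (ƛ M) ≟ (ƛ N)       = map′ (cong ƛ_) (λ { refl → refl }) (M ≟ N)
  (ƛ _) ≟ (_ · _)     = no λ ()
  (_ · _) ≟ var _     = no λ ()
  (_ · _) ≟ (ƛ _)     = no λ ()
  (M · N) ≟ (M′ · N′) = map′ (λ { (refl , refl) → refl }) (λ { refl → refl , refl })
                             ((M ≟ M′) ×-dec (N ≟ N′))

  extᵣ : (ℕ → ℕ) → ℕ → ℕ
  extᵣ ρ zero    = zero
  extᵣ ρ (suc x) = suc (ρ x)

  rename : (ℕ → ℕ) → Λ → Λ
  rename ρ (var x) = var (ρ x)
  rename ρ (ƛ M)   = ƛ rename (extᵣ ρ) M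
  rename ρ (M · N) = rename ρ M · rename ρ N

  ext : (ℕ → Λ) → ℕ → Λ
  ext σ zero    = var zero
  ext σ (suc x) = rename suc (σ x)

  subst : (ℕ → Λ) → Λ → Λ
  subst σ (var x) = σ x
  subst σ (ƛ M)   = ƛ subst (ext σ) M
  subst σ (M · N) = subst σ M · subst σ N

  -- The indices above the eliminated binder are shifted down.
  single : Λ → ℕ → Λ
  single N zero    = N
  single N (suc x) = var x

  _[_] : Λ → Λ → Λ
  M [ N ] = subst (single N) M

  -- A derivation of M →β N is an occurrence of a redex in M together with
  -- the result N of firing it.
  data _→β_ : Λ → Λ → Set where
    β  : ∀ {M N}              → (ƛ M) · N →β M [ N ]
    ξ  : ∀ {M M′}   → M →β M′ → ƛ M →β ƛ M′
    ·ˡ : ∀ {M M′ N} → M →β M′ → M · N →β M′ · N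
    ·ʳ : ∀ {M N N′} → N →β N′ → M · N →β M · N′

  _↠β_ : Λ → Λ → Set
  _↠β_ = Star _→β_

  Normal : Λ → Set
  Normal M = ∀ N → ¬ (M →β N)

  WeaklyNormalising : Λ → Set
  WeaklyNormalising M = ∃ λ N → M ↠β N × Normal N

  Redex : Λ → Set
  Redex M = ∃ (M →β_)

  contract : ∀ {M} → Redex M → Λ
  contract = proj₁

  -- Terms are written fully parenthesised, as x, (MN) and (λx.M), each
  -- variable being one symbol: `width` counts the symbols of a term, and
  -- `begin` is the number of symbols before the first one of a redex.
  width : Λ → ℕ
  width (var x) = 1
  width (ƛ M)   = 5 ℕ.+ width M
  width (M · N) = 2 ℕ.+ width M ℕ.+ width N

  begin : ∀ {M N} → M →β N → ℕ
  begin β              = 0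
  begin (ξ r)          = 4 ℕ.+ begin r
  begin (·ˡ r)         = 1 ℕ.+ begin r
  begin (·ʳ {M = M} r) = 1 ℕ.+ width M ℕ.+ begin r

  position : ∀ {M} → Redex M → ℕ
  position (_ , r) = begin r

  headRedex : ∀ M N → List (Redex (M · N))
  headRedex (ƛ M) N = (_ , β) ∷ []
  headRedex _     N = []

  redexes : ∀ M → List (Redex M)
  redexes (var x) = []
  redexes (ƛ M)   = map (λ (_ , r) → _ , ξ r) (redexes M)
  redexes (M · N) = headRedex M N
                 ++ map (λ (_ , r) → _ , ·ˡ r) (redexes M)
                 ++ map (λ (_ , r) → _ , ·ʳ r) (redexes N)

  redexes-complete : ∀ {M N} (r : M →β N) → (N , r) ∈ redexes M
  redexes-complete β      = here refl
  redexes-complete (ξ r)  = ∈-map⁺ _ (redexes-complete r)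
  redexes-complete (·ˡ {M = M} {N = N} r) =
    ∈-++⁺ʳ (headRedex M N) (∈-++⁺ˡ (∈-map⁺ _ (redexes-complete r)))
  redexes-complete (·ʳ {M = M} {N = N} r) =
    ∈-++⁺ʳ (headRedex M N) (∈-++⁺ʳ (map _ (redexes M)) (∈-map⁺ _ (redexes-complete r)))

  -- Distinct redexes of a term have distinct beginnings, so ties do not occur.
  leftmost rightmost : ∀ {M} → Redex M → List (Redex M) → Redex M
  leftmost  = argmin position
  rightmost = argmax position

module Strategy where

  open import Data.List.Base using (List; []; _∷_; map; concatMap; deduplicate)
  open import Data.Maybe.Base using (Maybe; just; nothing; maybe′)
  open import Data.Bool.Base using (if_then_else_)
  open import Data.List.Extrema ℕₚ.≤-totalOrder using (argmin-sel; argmax-sel)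
  open import Data.List.Membership.Propositional using (_∈_; _∉_; lose)
  open import Data.List.Membership.Propositional.Properties
    using (∈-map⁺; ∈-concatMap⁺; ∈-deduplicate⁺)
  open import Data.List.Relation.Unary.Any using (here; there)
  open import Data.Rational as ℚ using (0ℚ; 1ℚ)
  open import Data.Rational.Properties as ℚₚ using ()
  open import Data.Sum.Base using (_⊎_; inj₁; inj₂)
  open import Relation.Binary.PropositionalEquality
    using (_≡_; _≢_; refl; trans; cong; cong₂)
  open import Relation.Nullary using (does; yes; no; contradiction)
  open Real
  open Lambda

  δ : Λ → Λ → ℝ
  δ M N = if does (M ≟ N) then 1ℝ else 0ℝ

  P : ℝ → Λ → Maybe (Λ → ℝ)
  P ε M with redexes M
  ... | []     = nothing
  ... | r ∷ rs = just λ N → ε * δ (contract (leftmost r rs)) N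
                          + (1ℝ - ε) * δ (contract (rightmost r rs)) N

  ℙ : ℝ → Λ → Λ → ℝ
  ℙ ε M N = maybe′ (λ p → p N) 0ℝ (P ε M)

  -- The terms reached from M by exactly i β-steps, without repetition: a
  -- finite set outside of which ρ ε M i vanishes, over which the sums over
  -- all terms are taken.
  reachable : Λ → ℕ → List Λ
  reachable M zero    = M ∷ []
  reachable M (suc i) =
    deduplicate _≟_ (concatMap (λ L → map contract (redexes L)) (reachable M i))

  ρ : ℝ → Λ → ℕ → Λ → ℝ
  ρ ε M zero    N = δ M N
  ρ ε M (suc i) N = ∑ (reachable M i) λ L → ρ ε M i L * ℙ ε L N

  private
    δ-≢ : ∀ {M N} → M ≢ N → δ M N ≡ 0ℝ
    δ-≢ {M} {N} M≢N with M ≟ N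
    ... | yes M≡N = contradiction M≡N M≢N
    ... | no  _   = refl

    contract-∈ : ∀ {M} (q r : Redex M) rs → q ≡ r ⊎ q ∈ rs → contract q ∈ map contract (r ∷ rs)
    contract-∈ q r rs (inj₁ refl) = here refl
    contract-∈ q r rs (inj₂ q∈)   = there (∈-map⁺ contract q∈)

    ℙ-vanishes : ∀ ε M N → N ∉ map contract (redexes M) → ∀ k → seq (ℙ ε M N) k ≡ 0ℚ
    ℙ-vanishes ε M N N∉ k with redexes M
    ... | []     = refl
    ... | r ∷ rs
      rewrite δ-≢ {contract (leftmost r rs)} {N}
                (λ { refl → N∉ (contract-∈ (leftmost r rs) r rs (argmin-sel position r rs)) })
            | δ-≢ {contract (rightmost r rs)} {N}
                (λ { refl → N∉ (contract-∈ (rightmost r rs) r rs (argmax-sel position r rs)) })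
      = cong₂ ℚ._+_ (ℚₚ.*-zeroʳ (seq ε k)) (ℚₚ.*-zeroʳ (1ℚ ℚ.+ ℚ.- seq ε k))

    ∑-vanishes : ∀ {A : Set} (as : List A) f k →
                 (∀ a → a ∈ as → seq (f a) k ≡ 0ℚ) → seq (∑ as f) k ≡ 0ℚ
    ∑-vanishes []       f k z = refl
    ∑-vanishes (a ∷ as) f k z =
      cong₂ ℚ._+_ (z a (here refl)) (∑-vanishes as f k (λ b b∈ → z b (there b∈)))

  ρ-vanishes : ∀ ε M i N → N ∉ reachable M i → ∀ k → seq (ρ ε M i N) k ≡ 0ℚ
  ρ-vanishes ε M zero    N N∉ k = cong (λ x → seq x k) (δ-≢ {M} {N} λ { refl → N∉ (here refl) })
  ρ-vanishes ε M (suc i) N N∉ k = ∑-vanishes (reachable M i) _ k λ L L∈ →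
    trans (cong (seq (ρ ε M i L) k ℚ.*_)
             (ℙ-vanishes ε L N
                (λ N∈ → N∉ (∈-deduplicate⁺ _≟_
                   (∈-concatMap⁺ (λ L → map contract (redexes L)) (lose L∈ N∈)))) k))
          (ℚₚ.*-zeroʳ (seq (ρ ε M i L) k))

  mass : ℝ → Λ → ℕ → ℝ
  mass ε M i = ∑ (reachable M i) (ρ ε M i)

  -- Finiteness of a sum in [0,+∞] is convergence of the series to a real.
  Steps_[_]≡_ : ℝ → Λ → ℝ → Set
  Steps ε [ M ]≡ s = HasSum (λ i → mass ε M (suc i)) s

  PAST : ℝ → Set
  PAST ε = ∀ M → WeaklyNormalising M → ∃ λ s → Steps ε [ M ]≡ s

open Real public using (ℝ; 0ℝ; 1ℝ; _≤_; _<_)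
open Strategy public using (PAST)

{-# OPTIONS --safe #-}
module Submission where

-- Let ℓ(M) be the length of the leftmost reduction of M, which is finite for
-- weakly normalising M by standardisation.  Any β-step M → N projects the
-- leftmost reduction of M onto one of N that is not longer, so an RI-step does
-- not increase ℓ while an LO-step decreases it by 1.  Hence one step of P_ε
-- multiplies the expectation of 2^ℓ by at most ε/2 + (1 − ε) < 1, and the mass,
-- which 2^ℓ dominates, decays geometrically.  A real being a sequence of
-- rationals, this estimate is made on each late enough approximation of ε,
-- with absolute values since an approximation of ε may exceed 1.

open import Defs
open Real using (seq; cauchy; mkℝ; IsCauchy; partialSum; HasSum; ∑)
open Lambda hiding (begin)
open Strategy hiding (P)
open import Data.Integer.Base as ℤ using (+_)
import Data.Integer.Properties as ℤₚ
open import Data.List.Base using (List; []; _∷_; map)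
open import Data.List.Membership.Propositional using (_∈_; find)
open import Data.List.Membership.Propositional.Properties using (∈-map⁻; ∈-concatMap⁻; ∈-deduplicate⁻)
open import Data.List.Relation.Unary.All as All using ()
open import Data.List.Relation.Unary.AllPairs using ([]; _∷_)
open import Data.List.Relation.Unary.Any using (here; there)
open import Data.List.Relation.Unary.Unique.DecPropositional.Properties _≟_ using (deduplicate-!)
open import Data.List.Relation.Unary.Unique.Propositional using (Unique)
open import Data.Nat.Base as ℕ using (ℕ; zero; suc; z≤n; s≤s)
import Data.Nat.Properties as ℕₚ
open import Data.List.Extrema ℕₚ.≤-totalOrder using (f[argmin]≤f[⊤]; f[argmin]≤f[xs])
open import Data.Product using (∃; _×_; _,_; proj₁; proj₂)
open import Data.Rational as ℚ using (ℚ; 0ℚ; 1ℚ; ½; ∣_∣; _/_; 1/_; toℚᵘ)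
open import Data.Rational.Properties as ℚₚ using ()
open import Algebra.Definitions.RawSemiring ℚ.+-*-rawSemiring using (_^_)
open import Data.Rational.Solver using (module +-*-Solver)
open import Data.Rational.Unnormalised.Base as ℚᵘ using (mkℚᵘ; *≤*; *≡*)
import Data.Rational.Unnormalised.Properties as ℚᵘₚ
open import Data.Sum.Base as Sum using (_⊎_; inj₁; inj₂)
open import Function.Base using (_∘_)
open import Relation.Binary.Construct.Closure.ReflexiveTransitive
  using (Star; _◅_; _◅◅_; gmap) renaming (ε to nil)
open import Relation.Binary.PropositionalEquality as ≡
  using (_≡_; _≗_; refl; sym; trans; cong; cong₂)
open import Relation.Nullary using (¬_; yes; no; contradiction)
open +-*-Solver using (solve; _:+_; _:*_; _:-_; :-_; _:=_; con)

-- Algebra of renaming and substitution.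

extᵣ-cong : ∀ {ρ ρ′} → ρ ≗ ρ′ → extᵣ ρ ≗ extᵣ ρ′
extᵣ-cong eq zero    = refl
extᵣ-cong eq (suc x) = cong suc (eq x)

ext-cong : ∀ {σ τ} → σ ≗ τ → ext σ ≗ ext τ
ext-cong eq zero    = refl
ext-cong eq (suc x) = cong (rename suc) (eq x)

rename-cong : ∀ {ρ ρ′} → ρ ≗ ρ′ → rename ρ ≗ rename ρ′
rename-cong eq (var x) = cong var (eq x)
rename-cong eq (ƛ M)   = cong ƛ_ (rename-cong (extᵣ-cong eq) M)
rename-cong eq (M · N) = cong₂ _·_ (rename-cong eq M) (rename-cong eq N)

subst-cong : ∀ {σ τ} → σ ≗ τ → subst σ ≗ subst τ
subst-cong eq (var x) = eq x
subst-cong eq (ƛ M)   = cong ƛ_ (subst-cong (ext-cong eq) M)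
subst-cong eq (M · N) = cong₂ _·_ (subst-cong eq M) (subst-cong eq N)

subst-var : ∀ {σ} → σ ≗ var → ∀ M → subst σ M ≡ M
subst-var eq (var x) = eq x
subst-var eq (ƛ M)   = cong ƛ_ (subst-var (λ { zero → refl ; (suc x) → cong (rename suc) (eq x) }) M)
subst-var eq (M · N) = cong₂ _·_ (subst-var eq M) (subst-var eq N)

rename-rename : ∀ ρ ρ′ M → rename ρ (rename ρ′ M) ≡ rename (ρ ∘ ρ′) M
rename-rename ρ ρ′ (var x) = refl
rename-rename ρ ρ′ (ƛ M)   = cong ƛ_ (trans (rename-rename (extᵣ ρ) (extᵣ ρ′) M)
  (rename-cong (λ { zero → refl ; (suc x) → refl }) M))
rename-rename ρ ρ′ (M · N) = cong₂ _·_ (rename-rename ρ ρ′ M) (rename-rename ρ ρ′ N)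

subst-rename : ∀ σ ρ M → subst σ (rename ρ M) ≡ subst (σ ∘ ρ) M
subst-rename σ ρ (var x) = refl
subst-rename σ ρ (ƛ M)   = cong ƛ_ (trans (subst-rename (ext σ) (extᵣ ρ) M)
  (subst-cong (λ { zero → refl ; (suc x) → refl }) M))
subst-rename σ ρ (M · N) = cong₂ _·_ (subst-rename σ ρ M) (subst-rename σ ρ N)

rename-subst : ∀ ρ σ M → rename ρ (subst σ M) ≡ subst (rename ρ ∘ σ) M
rename-subst ρ σ (var x) = refl
rename-subst ρ σ (ƛ M)   = cong ƛ_ (trans (rename-subst (extᵣ ρ) (ext σ) M)
  (subst-cong (λ { zero → refl ; (suc x) → trans (rename-rename (extᵣ ρ) suc (σ x))
                                             (sym (rename-rename suc ρ (σ x))) }) M))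
rename-subst ρ σ (M · N) = cong₂ _·_ (rename-subst ρ σ M) (rename-subst ρ σ N)

subst-subst : ∀ τ σ M → subst τ (subst σ M) ≡ subst (subst τ ∘ σ) M
subst-subst τ σ (var x) = refl
subst-subst τ σ (ƛ M)   = cong ƛ_ (trans (subst-subst (ext τ) (ext σ) M)
  (subst-cong (λ { zero → refl ; (suc x) → trans (subst-rename (ext τ) suc (σ x))
                                             (sym (rename-subst suc τ (σ x))) }) M))
subst-subst τ σ (M · N) = cong₂ _·_ (subst-subst τ σ M) (subst-subst τ σ N)

rename-[] : ∀ ρ M N → rename ρ (M [ N ]) ≡ rename (extᵣ ρ) M [ rename ρ N ]
rename-[] ρ M N = trans (rename-subst ρ (single N) M)
  (trans (subst-cong (λ { zero → refl ; (suc x) → refl }) M)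
         (sym (subst-rename (single (rename ρ N)) (extᵣ ρ) M)))

subst-[] : ∀ σ M N → subst σ (M [ N ]) ≡ subst (ext σ) M [ subst σ N ]
subst-[] σ M N = trans (subst-subst σ (single N) M)
  (trans (subst-cong (λ { zero    → refl
                        ; (suc x) → sym (trans (subst-rename (single (subst σ N)) suc (σ x))
                                               (subst-var (λ _ → refl) (σ x))) }) M)
         (sym (subst-subst (single (subst σ N)) (ext σ) M)))

-- Weak-head steps and standard reduction.

infix 4 _→w_ _↠w_ _→l_ _↠l_ _⇛_

-- Unlike leftmost steps, these are stable under substitution: an abstraction substituted for a head
-- variable can create a redex further left, but never left of a weak-head redex.
data _→w_ : Λ → Λ → Set where
  β  : ∀ {M N} → (ƛ M) · N →w M [ N ]
  ·ˡ : ∀ {M M′ N} → M →w M′ → M · N →w M′ · N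

_↠w_ : Λ → Λ → Set
_↠w_ = Star _→w_

rename-→w : ∀ ρ {M N} → M →w N → rename ρ M →w rename ρ N
rename-→w ρ (β {M} {N}) rewrite rename-[] ρ M N = β
rename-→w ρ (·ˡ s)      = ·ˡ (rename-→w ρ s)

subst-→w : ∀ σ {M N} → M →w N → subst σ M →w subst σ N
subst-→w σ (β {M} {N}) rewrite subst-[] σ M N = β
subst-→w σ (·ˡ s)      = ·ˡ (subst-→w σ s)

-- Kashima's inductive form of standard reduction: weak-head steps down to the
-- outermost constructor of the result, then reduction inside its components.
data _⇛_ : Λ → Λ → Set where
  var : ∀ {M x}       → M ↠w var x → M ⇛ var x
  lam : ∀ {M A B}     → M ↠w ƛ A   → A ⇛ B → M ⇛ ƛ B
  app : ∀ {M A B C D} → M ↠w A · B → A ⇛ C → B ⇛ D → M ⇛ C · D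

⇛-refl : ∀ M → M ⇛ M
⇛-refl (var x) = var nil
⇛-refl (ƛ M)   = lam nil (⇛-refl M)
⇛-refl (M · N) = app nil (⇛-refl M) (⇛-refl N)

↠w-⇛ : ∀ {M M′ N} → M ↠w M′ → M′ ⇛ N → M ⇛ N
↠w-⇛ ss (var ts)     = var (ss ◅◅ ts)
↠w-⇛ ss (lam ts p)   = lam (ss ◅◅ ts) p
↠w-⇛ ss (app ts p q) = app (ss ◅◅ ts) p q

rename-⇛ : ∀ ρ {M N} → M ⇛ N → rename ρ M ⇛ rename ρ N
rename-⇛ ρ (var ss)     = var (gmap (rename ρ) (rename-→w ρ) ss)
rename-⇛ ρ (lam ss p)   = lam (gmap (rename ρ) (rename-→w ρ) ss) (rename-⇛ (extᵣ ρ) p)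
rename-⇛ ρ (app ss p q) = app (gmap (rename ρ) (rename-→w ρ) ss) (rename-⇛ ρ p) (rename-⇛ ρ q)

subst-⇛ : ∀ {σ τ} → (∀ x → σ x ⇛ τ x) → ∀ {M N} → M ⇛ N → subst σ M ⇛ subst τ N
subst-⇛ {σ} h (var {x = x} ss) = ↠w-⇛ (gmap (subst σ) (subst-→w σ) ss) (h x)
subst-⇛ {σ} h (lam ss p) = lam (gmap (subst σ) (subst-→w σ) ss)
  (subst-⇛ (λ { zero → var nil ; (suc x) → rename-⇛ suc (h x) }) p)
subst-⇛ {σ} h (app ss p q) = app (gmap (subst σ) (subst-→w σ) ss) (subst-⇛ h p) (subst-⇛ h q)

[]-⇛ : ∀ {M M′ N N′} → M ⇛ M′ → N ⇛ N′ → M [ N ] ⇛ M′ [ N′ ]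
[]-⇛ p q = subst-⇛ (λ { zero → q ; (suc x) → var nil }) p

-- A standard reduction absorbs one more step at its end. If that step fires a root redex, the
-- abstraction was already reached by weak-head steps in function position, so its ancestor can be
-- fired by a weak-head step; substituting the remaining reductions into each other stays standard.
⇛-→β : ∀ {M N P} → M ⇛ N → N →β P → M ⇛ P
⇛-→β (app ss (lam ts p) q) β = ↠w-⇛ (ss ◅◅ gmap (_· _) ·ˡ ts ◅◅ (β ◅ nil)) ([]-⇛ p q)
⇛-→β (lam ss p)   (ξ r)  = lam ss (⇛-→β p r)
⇛-→β (app ss p q) (·ˡ r) = app ss (⇛-→β p r) q
⇛-→β (app ss p q) (·ʳ r) = app ss p (⇛-→β q r)

→β⇒⇛ : ∀ {M N} → M →β N → M ⇛ N
→β⇒⇛ = ⇛-→β (⇛-refl _)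

⇛-↠β : ∀ {M N P} → M ⇛ N → N ↠β P → M ⇛ P
⇛-↠β p nil      = p
⇛-↠β p (r ◅ rs) = ⇛-↠β (⇛-→β p r) rs

-- Leftmost steps and their projection along standard reductions.

data Lam : Λ → Set where
  lam : ∀ {M} → Lam (ƛ M)

-- The leftmost step without positions: the side conditions say that no redex begins further left,
-- neither at the root nor in the function part.
data _→l_ : Λ → Λ → Set where
  β  : ∀ {M N} → (ƛ M) · N →l M [ N ]
  ξ  : ∀ {M M′} → M →l M′ → ƛ M →l ƛ M′
  ·ˡ : ∀ {M M′ N} → ¬ Lam M → M →l M′ → M · N →l M′ · N
  ·ʳ : ∀ {M N N′} → ¬ Lam M → Normal M → N →l N′ → M · N →l M · N′

→l⇒→β : ∀ {M N} → M →l N → M →β N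
→l⇒→β β          = β
→l⇒→β (ξ s)      = ξ (→l⇒→β s)
→l⇒→β (·ˡ _ s)   = ·ˡ (→l⇒→β s)
→l⇒→β (·ʳ _ _ s) = ·ʳ (→l⇒→β s)

→w⇒→l : ∀ {M N} → M →w N → M →l N
→w⇒→l β             = β
-- Splitting `s` exposes its source as an application, hence not an abstraction.
→w⇒→l (·ˡ s@β)      = ·ˡ (λ ()) (→w⇒→l s)
→w⇒→l (·ˡ s@(·ˡ _)) = ·ˡ (λ ()) (→w⇒→l s)

→l-deterministic : ∀ {M N P} → M →l N → M →l P → N ≡ P
→l-deterministic β          β           = refl
→l-deterministic β          (·ˡ ¬l _)   = contradiction lam ¬l
→l-deterministic β          (·ʳ ¬l _ _) = contradiction lam ¬l
→l-deterministic (ξ s)      (ξ t)       = cong ƛ_ (→l-deterministic s t)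
→l-deterministic (·ˡ ¬l _)  β           = contradiction lam ¬l
→l-deterministic (·ˡ _ s)   (·ˡ _ t)    = cong (_· _) (→l-deterministic s t)
→l-deterministic (·ˡ _ s)   (·ʳ _ n _)  = contradiction (→l⇒→β s) (n _)
→l-deterministic (·ʳ ¬l _ _) β          = contradiction lam ¬l
→l-deterministic (·ʳ _ n _) (·ˡ _ t)    = contradiction (→l⇒→β t) (n _)
→l-deterministic (·ʳ _ _ s) (·ʳ _ _ t)  = cong (_ ·_) (→l-deterministic s t)

-- A weak-head step is a β-step, so every weak-head prefix is empty and nothing but the constructors
-- of `M` is rebuilt.
normal-⇛ : ∀ {M N} → Normal M → M ⇛ N → N ≡ M
normal-⇛ n (var nil)         = refl
normal-⇛ n (lam nil p)       = cong ƛ_ (normal-⇛ (λ _ → n _ ∘ ξ) p)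
normal-⇛ n (app nil p q)     = cong₂ _·_ (normal-⇛ (λ _ → n _ ∘ ·ˡ) p) (normal-⇛ (λ _ → n _ ∘ ·ʳ) q)
normal-⇛ n (var (s ◅ _))     = contradiction (→l⇒→β (→w⇒→l s)) (n _)
normal-⇛ n (lam (s ◅ _) _)   = contradiction (→l⇒→β (→w⇒→l s)) (n _)
normal-⇛ n (app (s ◅ _) _ _) = contradiction (→l⇒→β (→w⇒→l s)) (n _)

-- An abstraction arising from a non-abstraction has used up the leftmost redex,
-- so the second case never creates one; ·ˡ needs this to remain applicable.
Follows : Λ → Λ → Λ → Set
Follows M M′ N = M′ ⇛ N ⊎ (Lam N → Lam M) × ∃ λ N′ → N →l N′ × M′ ⇛ N′

⇛-→w-→l : ∀ {M M₁ M′ N} → M →w M₁ → M₁ ⇛ N → M →l M′ → M′ ⇛ N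
⇛-→w-→l s p t rewrite →l-deterministic (→w⇒→l s) t = p

-- If the standard reduction begins with a weak-head step, determinism makes it the given leftmost
-- step, and the rest starts at `M′`. Otherwise the outermost constructor is kept: a root redex
-- survives in `N`, and any other leftmost redex is followed into its component.
⇛-→l : ∀ {M M′ N} → M →l M′ → M ⇛ N → Follows M M′ N
⇛-→l β (app nil (lam nil p) q) = inj₂ ((λ ()) , _ , β , []-⇛ p q)
-- An abstraction has no weak-head step.
⇛-→l β (app nil (var (() ◅ _)) q)
⇛-→l β (app nil (lam (() ◅ _) p) q)
⇛-→l β (app nil (app (() ◅ _) _ _) q)
⇛-→l (ξ t) (lam nil p) = Sum.map (lam nil)
  (λ (_ , _ , u , p′) → (λ _ → lam) , _ , ξ u , lam nil p′) (⇛-→l t p)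
⇛-→l (·ˡ ¬l t) (app nil p q) = Sum.map (λ p′ → app nil p′ q)
  (λ (l , _ , u , p′) → (λ ()) , _ , ·ˡ (¬l ∘ l) u , app nil p′ q) (⇛-→l t p)
-- The function part is normal, so `p` leaves it unchanged and the side conditions of `·ʳ` carry
-- over.
⇛-→l (·ʳ ¬l n t) (app nil p q) = Sum.map (app nil p)
  (λ (_ , _ , u , q′) → (λ ()) , _ , ·ʳ-at (normal-⇛ n p) u , app nil p q′) (⇛-→l t q)
  where
  ·ʳ-at : ∀ {A D D′} → A ≡ _ → D →l D′ → A · D →l A · D′
  ·ʳ-at refl = ·ʳ ¬l n
⇛-→l t (var (s ◅ ss)) = inj₁ (⇛-→w-→l s (var ss) t)
⇛-→l t (lam (s ◅ ss) p) = inj₁ (⇛-→w-→l s (lam ss p) t)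
⇛-→l t (app (s ◅ ss) p q) = inj₁ (⇛-→w-→l s (app ss p q) t)

-- Standardisation for normal results.

_↠l_ : Λ → Λ → Set
_↠l_ = Star _→l_

Lam-↠l : ∀ {M N} → Lam M → M ↠l N → Lam N
Lam-↠l l   nil        = l
Lam-↠l lam (ξ _ ◅ ss) = Lam-↠l lam ss

-- Leftmost steps preserve being an abstraction. If the last function part is not one, no earlier
-- one is, so each step lifts by `·ˡ`.
↠l-·ˡ : ∀ {M M′ N} → ¬ Lam M′ → M ↠l M′ → M · N ↠l M′ · N
↠l-·ˡ ¬l nil      = nil
↠l-·ˡ ¬l (s ◅ ss) = ·ˡ (λ l → ¬l (Lam-↠l l (s ◅ ss))) s ◅ ↠l-·ˡ ¬l ss

-- In a normal application the function part is normal and not an abstraction. Reducing it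
-- completely before the argument is thus exactly the leftmost order.
⇛-normal : ∀ {M N} → M ⇛ N → Normal N → M ↠l N
⇛-normal (var ss)     n = gmap _ →w⇒→l ss
⇛-normal (lam ss p)   n = gmap _ →w⇒→l ss ◅◅ gmap ƛ_ ξ (⇛-normal p (λ _ → n _ ∘ ξ))
⇛-normal (app {C = C} ss p q) n =
  gmap _ →w⇒→l ss ◅◅ ↠l-·ˡ ¬l (⇛-normal p nˡ) ◅◅ gmap (_ ·_) (·ʳ ¬l nˡ) (⇛-normal q (λ _ → n _ ∘ ·ʳ))
  where
  nˡ : Normal C
  nˡ _ = n _ ∘ ·ˡ
  ¬l : ¬ Lam C
  ¬l lam = n _ β

-- The redex of least position, and the length of leftmost reduction.

begin<width : ∀ {M N} (r : M →β N) → Lambda.begin r ℕ.< width M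
begin<width β = s≤s z≤n
begin<width (ξ r) = s≤s (s≤s (s≤s (s≤s (ℕₚ.m≤n⇒m≤1+n (begin<width r)))))
begin<width (·ˡ {M = M} {N = N} r) =
  s≤s (ℕₚ.≤-trans (begin<width r) (ℕₚ.≤-trans (ℕₚ.m≤m+n (width M) (width N)) (ℕₚ.n≤1+n _)))
begin<width (·ʳ {M = M} r) = s≤s (ℕₚ.≤-trans (ℕₚ.+-monoʳ-< (width M) (begin<width r)) (ℕₚ.n≤1+n _))

-- Minimality yields the side conditions: a root redex would have position 0, and a redex in the
-- function part would begin within its width, before anything in the argument.
least⇒→l : ∀ {M N} (r : M →β N) → (∀ q → Lambda.begin r ℕ.≤ position {M} q) → M →l N
least⇒→l β     h = β
least⇒→l (ξ r) h = ξ (least⇒→l r λ (_ , q) → ℕₚ.+-cancelˡ-≤ 4 _ _ (h (_ , ξ q)))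
least⇒→l (·ˡ r) h =
  ·ˡ (λ { lam → ℕₚ.n≮0 (h (_ , β)) })
     (least⇒→l r λ (_ , q) → ℕₚ.+-cancelˡ-≤ 1 _ _ (h (_ , ·ˡ q)))
least⇒→l (·ʳ {M = M} r) h =
  ·ʳ (λ { lam → ℕₚ.n≮0 (h (_ , β)) })
     (λ _ q → ℕₚ.<⇒≱ (ℕₚ.<-≤-trans (begin<width q) (ℕₚ.m≤m+n (width M) (Lambda.begin r)))
                      (ℕₚ.+-cancelˡ-≤ 1 _ _ (h (_ , ·ˡ q))))
     (least⇒→l r λ (_ , q) → ℕₚ.+-cancelˡ-≤ (1 ℕ.+ width M) _ _ (h (_ , ·ʳ q)))

leftmost-→l : ∀ {M r rs} → redexes M ≡ r ∷ rs → M →l contract (leftmost r rs)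
leftmost-→l {M} {r} {rs} eq = least⇒→l (proj₂ (leftmost r rs)) λ q → least q (redexes-complete (proj₂ q))
  where
  least : ∀ q → q ∈ redexes M → position (leftmost r rs) ℕ.≤ position q
  least q q∈ rewrite eq with q∈
  ... | here refl = f[argmin]≤f[⊤] {f = position} r rs
  ... | there q∈′ = All.lookup (f[argmin]≤f[xs] {f = position} r rs) q∈′

redexes-[]⇒Normal : ∀ {M} → redexes M ≡ [] → Normal M
redexes-[]⇒Normal {M} eq N r with redexes M | redexes-complete r
redexes-[]⇒Normal refl N r | .[] | ()

-- The length of the leftmost reduction of a term, truncated at the first
-- argument: loLen (suc n) M ≤ n says that this reduction ends within n steps.
loLen     : ℕ → Λ → ℕ
loLenFrom : ∀ {M} → ℕ → List (Redex M) → ℕ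
loLen zero    M = 0
loLen (suc n) M = loLenFrom n (redexes M)
loLenFrom n []       = 0
loLenFrom n (r ∷ rs) = suc (loLen n (contract (leftmost r rs)))

loLen-normal : ∀ n {M} → Normal M → loLen n M ≡ 0
loLen-normal zero        nf = refl
loLen-normal (suc n) {M} nf with redexes M
... | []          = refl
... | (N , r) ∷ _ = contradiction r (nf N)

loLen-step : ∀ n {M N} → M →l N → loLen (suc n) M ≡ suc (loLen n N)
loLen-step n {M} s with redexes M in eq
... | []     = contradiction (→l⇒→β s) (redexes-[]⇒Normal eq _)
... | r ∷ rs = cong (suc ∘ loLen n) (→l-deterministic (leftmost-→l eq) s)

normal-or-step : ∀ M → Normal M ⊎ ∃ (M →l_)
normal-or-step M with redexes M in eq
... | []     = inj₁ (redexes-[]⇒Normal eq)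
... | r ∷ rs = inj₂ (_ , leftmost-→l eq)

loLen-suc≤ : ∀ n M → loLen (suc n) M ℕ.≤ suc (loLen n M)
loLen-suc≤ zero M with redexes M
... | []     = z≤n
... | r ∷ rs = s≤s z≤n
loLen-suc≤ (suc n) M with redexes M
... | []     = z≤n
... | r ∷ rs = s≤s (loLen-suc≤ n _)

-- A count strictly below the truncation means that the reduction has ended, so further fuel changes
-- nothing.
loLen-stable : ∀ n M → loLen n M ℕ.< n → loLen (suc n) M ≡ loLen n M
loLen-stable (suc n) M <n with redexes M
... | []     = refl
... | r ∷ rs = cong suc (loLen-stable n _ (ℕ.s<s⁻¹ <n))

-- Induction on the truncation. If the leftmost step of `M` is already part of the reduction to `N`,
-- the hypothesis concerns a truncation smaller by one, and `loLen-suc≤` charges the difference to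
-- that step. Otherwise `M` and `N` both make a leftmost step.
loLen-⇛ : ∀ n {M N} → M ⇛ N → loLen n N ℕ.≤ loLen n M
loLen-⇛ zero p = z≤n
loLen-⇛ (suc n) {M} {N} p with normal-or-step M
... | inj₁ nf with refl ← normal-⇛ nf p = ℕₚ.≤-refl
... | inj₂ (M′ , s) rewrite loLen-step n s with ⇛-→l s p
...   | inj₁ p′ = ℕₚ.≤-trans (loLen-suc≤ n N) (s≤s (loLen-⇛ n p′))
...   | inj₂ (_ , _ , t , p′) rewrite loLen-step n t = s≤s (loLen-⇛ n p′)

loLen-↠l : ∀ {M N} → M ↠l N → Normal N → ∃ λ n → loLen (suc n) M ℕ.≤ n
loLen-↠l nil       nf = 0 , ℕₚ.≤-reflexive (loLen-normal 1 nf)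
loLen-↠l (s ◅ ss) nf with n , ≤n ← loLen-↠l ss nf =
  suc n , ℕₚ.≤-trans (ℕₚ.≤-reflexive (loLen-step (suc n) s)) (s≤s ≤n)

weaklyNormalising⇒loLen : ∀ {M} → WeaklyNormalising M → ∃ λ n → loLen (suc n) M ℕ.≤ n
weaklyNormalising⇒loLen (N , rs , nf) = loLen-↠l (⇛-normal (⇛-↠β (⇛-refl _) rs) nf) nf

-- A step lowers the truncation along with the count. The bound by `n` makes the reduct's count
-- stable, which restores the same truncation on both sides.
loLen-leftmost : ∀ n {M r rs} → redexes M ≡ r ∷ rs → loLen (suc n) M ℕ.≤ n →
                 suc (loLen (suc n) (contract (leftmost r rs))) ≡ loLen (suc n) M
loLen-leftmost n {M} {r} {rs} eq ≤n = trans (cong suc (loLen-stable n _ bound)) (sym step)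
  where
  step : loLen (suc n) M ≡ suc (loLen n (contract (leftmost r rs)))
  step = loLen-step n (leftmost-→l eq)
  bound : loLen n (contract (leftmost r rs)) ℕ.< n
  bound = ℕₚ.≤-trans (ℕₚ.≤-reflexive (sym step)) ≤n

-- Inequalities between rationals.

open ℚₚ.≤-Reasoning

m⊔n⊔o≤p⇒ : ∀ m n o {p} → m ℕ.⊔ n ℕ.⊔ o ℕ.≤ p → m ℕ.≤ p × n ℕ.≤ p × o ℕ.≤ p
m⊔n⊔o≤p⇒ m n o ≤p = ℕₚ.m⊔n≤o⇒m≤o m n m⊔n≤p , ℕₚ.m⊔n≤o⇒n≤o m n m⊔n≤p , ℕₚ.m⊔n≤o⇒n≤o (m ℕ.⊔ n) o ≤p
  where
  m⊔n≤p = ℕₚ.m⊔n≤o⇒m≤o (m ℕ.⊔ n) o ≤p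

p≤∣p∣ : ∀ p → p ℚ.≤ ∣ p ∣
p≤∣p∣ p with ℚₚ.≤-total 0ℚ p
... | inj₁ 0≤p = ℚₚ.≤-reflexive (sym (ℚₚ.0≤p⇒∣p∣≡p 0≤p))
... | inj₂ p≤0 = ℚₚ.≤-trans p≤0 (ℚₚ.0≤∣p∣ p)

∣p∣≤q : ∀ {p q} → p ℚ.≤ q → ℚ.- p ℚ.≤ q → ∣ p ∣ ℚ.≤ q
∣p∣≤q {p} p≤q -p≤q with ℚₚ.∣p∣≡p∨∣p∣≡-p p
... | inj₁ eq = ≡.subst (ℚ._≤ _) (sym eq) p≤q
... | inj₂ eq = ≡.subst (ℚ._≤ _) (sym eq) -p≤q

∣p-q∣≡∣q-p∣ : ∀ p q → ∣ p ℚ.- q ∣ ≡ ∣ q ℚ.- p ∣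
∣p-q∣≡∣q-p∣ p q = trans (cong ∣_∣ (solve 2 (λ a b → a :- b := :- (b :- a)) refl p q)) (ℚₚ.∣-p∣≡∣p∣ (q ℚ.- p))

∣p-r∣≤∣p-q∣+∣q-r∣ : ∀ p q r → ∣ p ℚ.- r ∣ ℚ.≤ ∣ p ℚ.- q ∣ ℚ.+ ∣ q ℚ.- r ∣
∣p-r∣≤∣p-q∣+∣q-r∣ p q r = begin
  ∣ p ℚ.- r ∣                     ≡⟨ cong ∣_∣ (solve 3 (λ a b c → a :- c := (a :- b) :+ (b :- c)) refl p q r) ⟩
  ∣ (p ℚ.- q) ℚ.+ (q ℚ.- r) ∣     ≤⟨ ℚₚ.∣p+q∣≤∣p∣+∣q∣ (p ℚ.- q) (q ℚ.- r) ⟩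
  ∣ p ℚ.- q ∣ ℚ.+ ∣ q ℚ.- r ∣     ∎

∣p-q∣≤r⇒p≤q+r : ∀ p q {r} → ∣ p ℚ.- q ∣ ℚ.≤ r → p ℚ.≤ q ℚ.+ r
∣p-q∣≤r⇒p≤q+r p q {r} ≤r = begin
  p                    ≡⟨ solve 2 (λ a b → a := b :+ (a :- b)) refl p q ⟩
  q ℚ.+ (p ℚ.- q)      ≤⟨ ℚₚ.+-monoʳ-≤ q (p≤∣p∣ _) ⟩
  q ℚ.+ ∣ p ℚ.- q ∣    ≤⟨ ℚₚ.+-monoʳ-≤ q ≤r ⟩
  q ℚ.+ r              ∎

p≤p+q : ∀ p {q} → 0ℚ ℚ.≤ q → p ℚ.≤ p ℚ.+ q
p≤p+q p {q} 0≤q = ≡.subst (ℚ._≤ p ℚ.+ q) (ℚₚ.+-identityʳ p) (ℚₚ.+-monoʳ-≤ p 0≤q)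

p-q≤p : ∀ p {q} → 0ℚ ℚ.≤ q → p ℚ.- q ℚ.≤ p
p-q≤p p {q} 0≤q = ≡.subst (p ℚ.- q ℚ.≤_) (ℚₚ.+-identityʳ p) (ℚₚ.+-monoʳ-≤ p (ℚₚ.neg-antimono-≤ 0≤q))

p≤q⇒0≤q-p : ∀ {p q} → p ℚ.≤ q → 0ℚ ℚ.≤ q ℚ.- p
p≤q⇒0≤q-p {p} {q} p≤q = ≡.subst (ℚ._≤ q ℚ.- p) (ℚₚ.+-inverseʳ p) (ℚₚ.+-monoˡ-≤ (ℚ.- p) p≤q)

*-monoˡ : ∀ {p q r} → 0ℚ ℚ.≤ r → p ℚ.≤ q → r ℚ.* p ℚ.≤ r ℚ.* q
*-monoˡ {r = r} 0≤r = ℚₚ.*-monoˡ-≤-nonNeg r {{ℚ.nonNegative 0≤r}}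

*-monoʳ : ∀ {p q r} → 0ℚ ℚ.≤ r → p ℚ.≤ q → p ℚ.* r ℚ.≤ q ℚ.* r
*-monoʳ {r = r} 0≤r = ℚₚ.*-monoʳ-≤-nonNeg r {{ℚ.nonNegative 0≤r}}

0≤p*q : ∀ {p q} → 0ℚ ℚ.≤ p → 0ℚ ℚ.≤ q → 0ℚ ℚ.≤ p ℚ.* q
0≤p*q {p} {q} 0≤p 0≤q = ≡.subst (ℚ._≤ p ℚ.* q) (ℚₚ.*-zeroʳ p) (*-monoˡ 0≤p 0≤q)

0≤p^n : ∀ {p} n → 0ℚ ℚ.≤ p → 0ℚ ℚ.≤ p ^ n
0≤p^n zero    0≤p = ℚₚ.nonNegative⁻¹ 1ℚ
0≤p^n (suc n) 0≤p = 0≤p*q 0≤p (0≤p^n n 0≤p)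

half-pos : ∀ {p} → 0ℚ ℚ.< p → 0ℚ ℚ.< ½ ℚ.* p
half-pos {p} 0<p = ≡.subst (ℚ._< ½ ℚ.* p) (ℚₚ.*-zeroʳ ½) (ℚₚ.*-monoʳ-<-pos ½ 0<p)

½*p+½*p≡p : ∀ p → ½ ℚ.* p ℚ.+ ½ ℚ.* p ≡ p
½*p+½*p≡p p = trans (sym (ℚₚ.*-distribʳ-+ p ½ ½)) (ℚₚ.*-identityˡ p)

-- Geometric decay and convergence of geometrically bounded series.

suc/1 : ∀ n → + suc n / 1 ≡ 1ℚ ℚ.+ + n / 1
-- `_/_` divides by a gcd, so the equation is checked on unnormalised fractions.
suc/1 n = ℚₚ.toℚᵘ-injective (ℚᵘₚ.≃-trans (ℚₚ.toℚᵘ-fromℚᵘ (mkℚᵘ (+ suc n) 0)) (ℚᵘₚ.≃-sym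
  (ℚᵘₚ.≃-trans (ℚₚ.toℚᵘ-homo-+ 1ℚ (+ n / 1))
  (ℚᵘₚ.≃-trans (ℚᵘₚ.+-congʳ (toℚᵘ 1ℚ) (ℚₚ.toℚᵘ-fromℚᵘ (mkℚᵘ (+ n) 0)))
     (*≡* (cong (ℤ._* + 1) (cong (λ z → + 1 ℤ.+ z) (ℤₚ.*-identityʳ (+ n)))))))))

archimedean : ∀ p → ∃ λ n → p ℚ.≤ + n / 1
archimedean p = n , ℚₚ.toℚᵘ-cancel-≤ (ℚᵘₚ.≤-trans {j = mkℚᵘ (+ n) 0} (bound p)
                      (ℚᵘₚ.≤-reflexive (ℚᵘₚ.≃-sym (ℚₚ.toℚᵘ-fromℚᵘ (mkℚᵘ (+ n) 0)))))
  where
  -- The denominator is at least 1, so the absolute value of the numerator is large enough.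
  n = ℤ.∣ ℚ.numerator p ∣
  i≤∣i∣ : ∀ i → i ℤ.≤ + ℤ.∣ i ∣
  i≤∣i∣ (+ m)        = ℤₚ.≤-refl
  i≤∣i∣ (ℤ.-[1+ m ]) = ℤ.-≤+
  bound : ∀ p → toℚᵘ p ℚᵘ.≤ mkℚᵘ (+ ℤ.∣ ℚ.numerator p ∣) 0
  bound p@record{} = *≤* (ℤₚ.≤-trans (ℤₚ.≤-reflexive (ℤₚ.*-identityʳ _))
    (ℤₚ.≤-trans (i≤∣i∣ (ℚ.numerator p)) (ℤₚ.≤-trans (ℤ.+≤+ (ℕₚ.m≤m*n m (ℚ.denominatorℕ p)))
      (ℤₚ.≤-reflexive (ℤₚ.pos-* m (ℚ.denominatorℕ p))))))
    where m = ℤ.∣ ℚ.numerator p ∣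

0≤n/1 : ∀ n → 0ℚ ℚ.≤ + n / 1
0≤n/1 n = ℚₚ.nonNegative⁻¹ (+ n / 1) {{ℚₚ.normalize-nonNeg n 1}}

-- Bernoulli's inequality in a form without division: the power decays at least as fast as 1/(1 +
-- nt). The induction rests on (1 - t)(1 + (1 + n)t) = 1 + nt - (1 + n)t².
bernoulli : ∀ {t} → 0ℚ ℚ.≤ t → t ℚ.≤ 1ℚ → ∀ n → (1ℚ ℚ.- t) ^ n ℚ.* (1ℚ ℚ.+ + n / 1 ℚ.* t) ℚ.≤ 1ℚ
bernoulli {t} 0≤t t≤1 zero = ℚₚ.≤-reflexive (trans (ℚₚ.*-identityˡ _)
  (trans (cong (1ℚ ℚ.+_) (ℚₚ.*-zeroˡ t)) (ℚₚ.+-identityʳ 1ℚ)))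
bernoulli {t} 0≤t t≤1 (suc n) = begin
  (1ℚ ℚ.- t) ℚ.* x ℚ.* (1ℚ ℚ.+ + suc n / 1 ℚ.* t)
    ≡⟨ cong (λ z → (1ℚ ℚ.- t) ℚ.* x ℚ.* (1ℚ ℚ.+ z ℚ.* t)) (suc/1 n) ⟩
  (1ℚ ℚ.- t) ℚ.* x ℚ.* (1ℚ ℚ.+ (1ℚ ℚ.+ y) ℚ.* t)
    ≡⟨ solve 3 (λ t x y → (con 1ℚ :- t) :* x :* (con 1ℚ :+ (con 1ℚ :+ y) :* t)
                        := x :* (con 1ℚ :+ y :* t) :- x :* ((con 1ℚ :+ y) :* (t :* t))) refl t x y ⟩
  x ℚ.* (1ℚ ℚ.+ y ℚ.* t) ℚ.- x ℚ.* ((1ℚ ℚ.+ y) ℚ.* (t ℚ.* t))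
    ≤⟨ p-q≤p _ (0≤p*q (0≤p^n n (p≤q⇒0≤q-p t≤1))
                 (0≤p*q (ℚₚ.≤-trans (0≤n/1 n) (≡.subst (y ℚ.≤_) (ℚₚ.+-comm y 1ℚ) (p≤p+q y (ℚₚ.nonNegative⁻¹ 1ℚ))))
                        (0≤p*q 0≤t 0≤t))) ⟩
  x ℚ.* (1ℚ ℚ.+ y ℚ.* t)
    ≤⟨ bernoulli 0≤t t≤1 n ⟩
  1ℚ ∎
  where
  x = (1ℚ ℚ.- t) ^ n
  y = + n / 1

geometric-null : ∀ {t D η} → 0ℚ ℚ.< t → t ℚ.≤ 1ℚ → 0ℚ ℚ.≤ D → 0ℚ ℚ.< η →
                 ∃ λ n → D ℚ.* (1ℚ ℚ.- t) ^ n ℚ.≤ η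
geometric-null {t} {D} {η} 0<t t≤1 0≤D 0<η = n , ℚₚ.*-cancelʳ-≤-pos (1ℚ ℚ.+ y) (begin
  D ℚ.* (1ℚ ℚ.- t) ^ n ℚ.* (1ℚ ℚ.+ y)   ≡⟨ ℚₚ.*-assoc D _ _ ⟩
  D ℚ.* ((1ℚ ℚ.- t) ^ n ℚ.* (1ℚ ℚ.+ y)) ≤⟨ *-monoˡ 0≤D (bernoulli (ℚₚ.<⇒≤ 0<t) t≤1 n) ⟩
  D ℚ.* 1ℚ                              ≡⟨ ℚₚ.*-identityʳ D ⟩
  D                                     ≡⟨ sym cancel ⟩
  D ℚ.* 1/ (η ℚ.* t) ℚ.* (η ℚ.* t)      ≤⟨ *-monoʳ (ℚₚ.<⇒≤ 0<ηt) D/ηt≤n ⟩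
  + n / 1 ℚ.* (η ℚ.* t)                 ≡⟨ solve 3 (λ n η t → n :* (η :* t) := η :* (n :* t)) refl (+ n / 1) η t ⟩
  η ℚ.* y                               ≤⟨ *-monoˡ (ℚₚ.<⇒≤ 0<η) (ℚₚ.≤-trans (p≤p+q y (ℚₚ.nonNegative⁻¹ 1ℚ)) (ℚₚ.≤-reflexive (ℚₚ.+-comm y 1ℚ))) ⟩
  η ℚ.* (1ℚ ℚ.+ y)                      ∎)
  where
  0<ηt : 0ℚ ℚ.< η ℚ.* t
  0<ηt = ℚₚ.positive⁻¹ (η ℚ.* t) {{ℚₚ.pos*pos⇒pos η {{ℚ.positive 0<η}} t {{ℚ.positive 0<t}}}}
  instance
    ηt-nonZero : ℚ.NonZero (η ℚ.* t)
    ηt-nonZero = ℚₚ.pos⇒nonZero (η ℚ.* t) {{ℚ.positive 0<ηt}}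
  -- With n ≥ D/(ηt), the target η(1 + nt) is at least D.
  n      = proj₁ (archimedean (D ℚ.* 1/ (η ℚ.* t)))
  D/ηt≤n = proj₂ (archimedean (D ℚ.* 1/ (η ℚ.* t)))
  y = + n / 1 ℚ.* t
  0≤y : 0ℚ ℚ.≤ y
  0≤y = 0≤p*q (0≤n/1 n) (ℚₚ.<⇒≤ 0<t)
  instance
    1+y-positive : ℚ.Positive (1ℚ ℚ.+ y)
    1+y-positive = ℚ.positive (ℚₚ.+-mono-<-≤ (ℚₚ.positive⁻¹ 1ℚ) 0≤y)
  cancel : D ℚ.* 1/ (η ℚ.* t) ℚ.* (η ℚ.* t) ≡ D
  cancel = trans (ℚₚ.*-assoc D _ _) (trans (cong (D ℚ.*_) (ℚₚ.*-inverseˡ (η ℚ.* t))) (ℚₚ.*-identityʳ D))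

-- The bound on the terms is uniform in k, hence the diagonal is Cauchy.
module _ (a : ℕ → ℝ) {C t : ℚ} {K : ℕ} (0≤C : 0ℚ ℚ.≤ C) (0<t : 0ℚ ℚ.< t) (t≤1 : t ℚ.≤ 1ℚ)
         (bound : ∀ i k → K ℕ.≤ k → ∣ seq (a i) k ∣ ℚ.≤ C ℚ.* (1ℚ ℚ.- t) ^ i) where

  private
    instance
      t-nonZero : ℚ.NonZero t
      t-nonZero = ℚₚ.pos⇒nonZero t {{ℚ.positive 0<t}}

    -- The sum C/t of the full geometric series with first term C and ratio 1 - t.
    D : ℚ
    D = C ℚ.* 1/ t

    0≤D : 0ℚ ℚ.≤ D
    0≤D = 0≤p*q 0≤C (ℚₚ.<⇒≤ (ℚₚ.positive⁻¹ (1/ t) {{ℚₚ.1/pos⇒pos t {{ℚ.positive 0<t}}}}))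

    C≡D*t : C ≡ D ℚ.* t
    C≡D*t = sym (trans (ℚₚ.*-assoc C _ _) (trans (cong (C ℚ.*_) (ℚₚ.*-inverseˡ t)) (ℚₚ.*-identityʳ C)))

    r : ℚ
    r = 1ℚ ℚ.- t

    S : ℕ → ℕ → ℚ
    S n k = seq (partialSum a n) k

    -- The right-hand side is the geometric sum from m up to but excluding n, since D r^n - D
    -- r^(n+1) = C r^n.
    telescope : ∀ {m n k} → K ℕ.≤ k → m ℕ.≤′ n → ∣ S n k ℚ.- S m k ∣ ℚ.≤ D ℚ.* r ^ m ℚ.- D ℚ.* r ^ n
    telescope {m} {k = k} K≤k ℕ.≤′-refl = ℚₚ.≤-reflexive
      (trans (cong ∣_∣ (ℚₚ.+-inverseʳ (S m k))) (sym (ℚₚ.+-inverseʳ (D ℚ.* r ^ m))))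
    telescope {m} {suc n} {k} K≤k (ℕ.≤′-step m≤n) = begin
      ∣ S n k ℚ.+ seq (a n) k ℚ.- S m k ∣
        ≡⟨ cong ∣_∣ (solve 3 (λ x y z → x :+ y :- z := (x :- z) :+ y) refl (S n k) (seq (a n) k) (S m k)) ⟩
      ∣ (S n k ℚ.- S m k) ℚ.+ seq (a n) k ∣
        ≤⟨ ℚₚ.∣p+q∣≤∣p∣+∣q∣ (S n k ℚ.- S m k) (seq (a n) k) ⟩
      ∣ S n k ℚ.- S m k ∣ ℚ.+ ∣ seq (a n) k ∣
        ≤⟨ ℚₚ.+-mono-≤ (telescope K≤k m≤n) (bound n k K≤k) ⟩
      (D ℚ.* r ^ m ℚ.- D ℚ.* r ^ n) ℚ.+ C ℚ.* r ^ n
        ≡⟨ cong (λ c → (D ℚ.* r ^ m ℚ.- D ℚ.* r ^ n) ℚ.+ c ℚ.* r ^ n) C≡D*t ⟩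
      (D ℚ.* r ^ m ℚ.- D ℚ.* r ^ n) ℚ.+ D ℚ.* t ℚ.* r ^ n
        ≡⟨ solve 4 (λ d t x y → (d :* x :- d :* y) :+ d :* t :* y := d :* x :- d :* ((con 1ℚ :- t) :* y))
             refl D t (r ^ m) (r ^ n) ⟩
      D ℚ.* r ^ m ℚ.- D ℚ.* (r ℚ.* r ^ n) ∎

    close : ∀ η → 0ℚ ℚ.< η → ∃ λ N → ∀ m n k → N ℕ.≤ m → N ℕ.≤ n → K ℕ.≤ k → ∣ S m k ℚ.- S n k ∣ ℚ.≤ η
    close η 0<η = N , λ m n k N≤m N≤n K≤k → begin
      ∣ S m k ℚ.- S n k ∣                           ≤⟨ ∣p-r∣≤∣p-q∣+∣q-r∣ (S m k) (S N k) (S n k) ⟩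
      ∣ S m k ℚ.- S N k ∣ ℚ.+ ∣ S N k ℚ.- S n k ∣   ≡⟨ cong (∣ S m k ℚ.- S N k ∣ ℚ.+_) (∣p-q∣≡∣q-p∣ (S N k) (S n k)) ⟩
      ∣ S m k ℚ.- S N k ∣ ℚ.+ ∣ S n k ℚ.- S N k ∣   ≤⟨ ℚₚ.+-mono-≤ (near K≤k N≤m) (near K≤k N≤n) ⟩
      ½ ℚ.* η ℚ.+ ½ ℚ.* η                           ≡⟨ ½*p+½*p≡p η ⟩
      η                                             ∎
      where
      N      = proj₁ (geometric-null 0<t t≤1 0≤D (half-pos 0<η))
      DrN≤½η = proj₂ (geometric-null 0<t t≤1 0≤D (half-pos 0<η))
      near : ∀ {n k} → K ℕ.≤ k → N ℕ.≤ n → ∣ S n k ℚ.- S N k ∣ ℚ.≤ ½ ℚ.* η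
      near {n} {k} K≤k N≤n = begin
        ∣ S n k ℚ.- S N k ∣            ≤⟨ telescope K≤k (ℕₚ.≤⇒≤′ N≤n) ⟩
        D ℚ.* r ^ N ℚ.- D ℚ.* r ^ n    ≤⟨ p-q≤p _ (0≤p*q 0≤D (0≤p^n n (p≤q⇒0≤q-p t≤1))) ⟩
        D ℚ.* r ^ N                    ≤⟨ DrN≤½η ⟩
        ½ ℚ.* η                        ∎

    -- Both diagonal entries are compared with the one partial sum of index `N₁`: uniform closeness
    -- costs a quarter of δ at each end, and the Cauchy property of that partial sum costs half.
    diagonal : IsCauchy (λ k → S k k)
    diagonal δ 0<δ = N₁ ℕ.⊔ N₂ ℕ.⊔ K , λ m n N≤m N≤n →
      let N₁≤m , N₂≤m , K≤m = m⊔n⊔o≤p⇒ N₁ N₂ K N≤m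
          N₁≤n , N₂≤n , K≤n = m⊔n⊔o≤p⇒ N₁ N₂ K N≤n
      in begin
      ∣ S m m ℚ.- S n n ∣
        ≤⟨ ∣p-r∣≤∣p-q∣+∣q-r∣ (S m m) (S N₁ m) (S n n) ⟩
      ∣ S m m ℚ.- S N₁ m ∣ ℚ.+ ∣ S N₁ m ℚ.- S n n ∣
        ≤⟨ ℚₚ.+-monoʳ-≤ ∣ S m m ℚ.- S N₁ m ∣ (∣p-r∣≤∣p-q∣+∣q-r∣ (S N₁ m) (S N₁ n) (S n n)) ⟩
      ∣ S m m ℚ.- S N₁ m ∣ ℚ.+ (∣ S N₁ m ℚ.- S N₁ n ∣ ℚ.+ ∣ S N₁ n ℚ.- S n n ∣)
        ≤⟨ ℚₚ.+-mono-≤ (close₁ m N₁ m N₁≤m ℕₚ.≤-refl K≤m)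
             (ℚₚ.+-mono-≤ (close₂ m n N₂≤m N₂≤n) (close₁ N₁ n n ℕₚ.≤-refl N₁≤n K≤n)) ⟩
      ½ ℚ.* (½ ℚ.* δ) ℚ.+ (½ ℚ.* δ ℚ.+ ½ ℚ.* (½ ℚ.* δ))
        ≡⟨ solve 1 (λ δ → con ½ :* (con ½ :* δ) :+ (con ½ :* δ :+ con ½ :* (con ½ :* δ)) := δ) refl δ ⟩
      δ ∎
      where
      c₁ = close (½ ℚ.* (½ ℚ.* δ)) (half-pos (half-pos 0<δ))
      N₁ = proj₁ c₁
      close₁ = proj₂ c₁
      c₂ = cauchy (partialSum a N₁) (½ ℚ.* δ) (half-pos 0<δ)
      N₂ = proj₁ c₂
      close₂ = proj₂ c₂

  geometric⇒HasSum : ∃ (HasSum a)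
  geometric⇒HasSum = mkℝ (λ k → S k k) diagonal , converges
    where
    converges : HasSum a (mkℝ (λ k → S k k) diagonal)
    -- The tolerance is a real; `d` is a positive rational below its approximations from `M` on.
    converges δ (d , 0<d , M , d≤δ) = N , λ n N≤n →
      (λ η 0<η → M ℕ.⊔ N ℕ.⊔ K , λ k p → let M≤k , N≤k , K≤k = m⊔n⊔o≤p⇒ M N K p in
         within k η (S n k) (S k k) 0<η M≤k (near n k k N≤n N≤k K≤k)) ,
      (λ η 0<η → M ℕ.⊔ N ℕ.⊔ K , λ k p → let M≤k , N≤k , K≤k = m⊔n⊔o≤p⇒ M N K p in
         within k η (S k k) (S n k) 0<η M≤k (near k n k N≤k N≤n K≤k))
      where
      N = proj₁ (close d 0<d)
      near = proj₂ (close d 0<d)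
      within : ∀ k η x y → 0ℚ ℚ.< η → M ℕ.≤ k → ∣ x ℚ.- y ∣ ℚ.≤ d → x ℚ.≤ y ℚ.+ seq δ k ℚ.+ η
      within k η x y 0<η M≤k near = begin
        x                    ≤⟨ ∣p-q∣≤r⇒p≤q+r x y near ⟩
        y ℚ.+ d              ≤⟨ ℚₚ.+-monoʳ-≤ y (≡.subst (ℚ._≤ seq δ k) (ℚₚ.+-identityˡ d) (d≤δ k M≤k)) ⟩
        y ℚ.+ seq δ k        ≤⟨ p≤p+q _ (ℚₚ.<⇒≤ 0<η) ⟩
        y ℚ.+ seq δ k ℚ.+ η  ∎

-- Finite sums of rationals.

module _ {A : Set} where

  sum : List A → (A → ℚ) → ℚ
  sum []       f = 0ℚ
  sum (a ∷ as) f = f a ℚ.+ sum as f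

  sum-mono : ∀ as {f g} → (∀ {a} → a ∈ as → f a ℚ.≤ g a) → sum as f ℚ.≤ sum as g
  sum-mono []       f≤g = ℚₚ.≤-refl
  sum-mono (a ∷ as) f≤g = ℚₚ.+-mono-≤ (f≤g (here refl)) (sum-mono as (λ a∈ → f≤g (there a∈)))

  sum-0 : ∀ as → sum as (λ _ → 0ℚ) ≡ 0ℚ
  sum-0 []       = refl
  sum-0 (a ∷ as) = trans (ℚₚ.+-identityˡ _) (sum-0 as)

  sum-+ : ∀ as f g → sum as (λ a → f a ℚ.+ g a) ≡ sum as f ℚ.+ sum as g
  sum-+ []       f g = refl
  sum-+ (a ∷ as) f g = trans (cong (f a ℚ.+ g a ℚ.+_) (sum-+ as f g))
    (solve 4 (λ w x y z → (w :+ x) :+ (y :+ z) := (w :+ y) :+ (x :+ z)) refl (f a) (g a) (sum as f) (sum as g))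

  sum-*ˡ : ∀ as c f → sum as (λ a → c ℚ.* f a) ≡ c ℚ.* sum as f
  sum-*ˡ []       c f = sym (ℚₚ.*-zeroʳ c)
  sum-*ˡ (a ∷ as) c f = trans (cong (c ℚ.* f a ℚ.+_) (sum-*ˡ as c f)) (sym (ℚₚ.*-distribˡ-+ c (f a) (sum as f)))

  ∣∑∣≤ : ∀ as f k → ∣ seq (∑ as f) k ∣ ℚ.≤ sum as (λ a → ∣ seq (f a) k ∣)
  ∣∑∣≤ []       f k = ℚₚ.≤-refl
  ∣∑∣≤ (a ∷ as) f k = ℚₚ.≤-trans (ℚₚ.∣p+q∣≤∣p∣+∣q∣ (seq (f a) k) (seq (∑ as f) k))
    (ℚₚ.+-monoʳ-≤ ∣ seq (f a) k ∣ (∣∑∣≤ as f k))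

sum-swap : ∀ {A B : Set} (as : List A) (bs : List B) (f : A → B → ℚ) →
           sum as (λ a → sum bs (f a)) ≡ sum bs (λ b → sum as (λ a → f a b))
sum-swap []       bs f = sym (sum-0 bs)
sum-swap (a ∷ as) bs f = trans (cong (sum bs (f a) ℚ.+_) (sum-swap as bs f))
  (sym (sum-+ bs (f a) (λ b → sum as (λ a → f a b))))

-- Reachable terms and the weight 2^ℓ.

2ℚ : ℚ
2ℚ = + 2 / 1

1≤2^n : ∀ n → 1ℚ ℚ.≤ 2ℚ ^ n
2^n≤2^1+n : ∀ n → 2ℚ ^ n ℚ.≤ 2ℚ ^ suc n
1≤2^n zero    = ℚₚ.≤-refl
1≤2^n (suc n) = ℚₚ.≤-trans (1≤2^n n) (2^n≤2^1+n n)
2^n≤2^1+n n = ≡.subst (2ℚ ^ n ℚ.≤_) (solve 1 (λ x → x :+ x := con 2ℚ :* x) refl (2ℚ ^ n))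
  (p≤p+q (2ℚ ^ n) (ℚₚ.≤-trans (ℚₚ.nonNegative⁻¹ 1ℚ) (1≤2^n n)))

2^-mono-≤ : ∀ {m n} → m ℕ.≤′ n → 2ℚ ^ m ℚ.≤ 2ℚ ^ n
2^-mono-≤ ℕ.≤′-refl = ℚₚ.≤-refl
2^-mono-≤ {n = suc n} (ℕ.≤′-step m≤n) = ℚₚ.≤-trans (2^-mono-≤ m≤n) (2^n≤2^1+n n)

reachable-⇛ : ∀ {M L} i → L ∈ reachable M i → M ⇛ L
reachable-⇛ zero    (here refl) = ⇛-refl _
reachable-⇛ {M} (suc i) L∈
  with find (∈-concatMap⁻ (λ L → map contract (redexes L)) {xs = reachable M i} (∈-deduplicate⁻ _≟_ _ L∈))
... | L , L∈ , N∈ with ∈-map⁻ contract N∈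
...   | (_ , r) , _ , refl = ⇛-→β (reachable-⇛ i L∈) r

-- Ensures that a sum over the list counts each Dirac mass at most once, as `sum-δ` requires.
reachable-unique : ∀ M i → Unique (reachable M i)
reachable-unique M zero    = All.[] ∷ []
reachable-unique M (suc i) = deduplicate-! _

module _ (n : ℕ) where

  weight : Λ → ℚ
  weight M = 2ℚ ^ loLen (suc n) M

  1≤weight : ∀ M → 1ℚ ℚ.≤ weight M
  1≤weight M = 1≤2^n (loLen (suc n) M)

  0≤weight : ∀ M → 0ℚ ℚ.≤ weight M
  0≤weight M = ℚₚ.≤-trans (ℚₚ.nonNegative⁻¹ 1ℚ) (1≤weight M)

  weight-⇛ : ∀ {M N} → M ⇛ N → weight N ℚ.≤ weight M
  weight-⇛ p = 2^-mono-≤ (ℕₚ.≤⇒≤′ (loLen-⇛ (suc n) p))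

  weight-leftmost : ∀ {L r rs} → redexes L ≡ r ∷ rs → loLen (suc n) L ℕ.≤ n →
                    weight (contract (leftmost r rs)) ≡ ½ ℚ.* weight L
  weight-leftmost {L} {r} {rs} eq ≤n rewrite sym (loLen-leftmost n {L} eq ≤n) =
    solve 1 (λ x → x := con ½ :* (con 2ℚ :* x)) refl (weight (contract (leftmost r rs)))

-- The contraction factor of one step: the leftmost reduct has half the weight, the rightmost one at
-- most the full weight.
drift : ℚ → ℚ
drift e = ½ ℚ.* ∣ e ∣ ℚ.+ ∣ 1ℚ ℚ.- e ∣

0≤drift : ∀ e → 0ℚ ℚ.≤ drift e
0≤drift e = ℚₚ.+-mono-≤ (0≤p*q (ℚₚ.nonNegative⁻¹ ½) (ℚₚ.0≤∣p∣ e)) (ℚₚ.0≤∣p∣ (1ℚ ℚ.- e))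

-- Expected weight along the computation, at the approximation of index `k`.

module _ (ε : ℝ) (k : ℕ) where

  ℙ-normal : ∀ {L} → redexes L ≡ [] → ∀ N → seq (ℙ ε L N) k ≡ 0ℚ
  ℙ-normal {L} eq N with redexes L
  ℙ-normal refl N | .[] = refl

  ℙ-reducible : ∀ {L r rs} → redexes L ≡ r ∷ rs → ∀ N →
    seq (ℙ ε L N) k ≡ seq ε k ℚ.* seq (δ (contract (leftmost r rs)) N) k
                      ℚ.+ (1ℚ ℚ.- seq ε k) ℚ.* seq (δ (contract (rightmost r rs)) N) k
  ℙ-reducible {L} eq N with redexes L
  ℙ-reducible refl N | _ = refl

  0≤δ : ∀ M N → 0ℚ ℚ.≤ seq (δ M N) k
  0≤δ M N with M ≟ N
  ... | yes _ = ℚₚ.nonNegative⁻¹ 1ℚ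
  ... | no  _ = ℚₚ.≤-refl

  -- Only an inequality, since `P` may be absent from the list; nonnegativity of `g` covers that
  -- case.
  sum-δ : ∀ P (g : Λ → ℚ) → (∀ N → 0ℚ ℚ.≤ g N) → ∀ {Ns} → Unique Ns →
          sum Ns (λ N → seq (δ P N) k ℚ.* g N) ℚ.≤ g P
  sum-δ P g 0≤g [] = 0≤g P
  sum-δ P g 0≤g {N ∷ Ns} (N∉ ∷ u) with P ≟ N
  ... | no  _    = begin
    0ℚ ℚ.* g N ℚ.+ sum Ns (λ N → seq (δ P N) k ℚ.* g N)  ≡⟨ cong (ℚ._+ _) (ℚₚ.*-zeroˡ (g N)) ⟩
    0ℚ ℚ.+ sum Ns (λ N → seq (δ P N) k ℚ.* g N)          ≡⟨ ℚₚ.+-identityˡ _ ⟩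
    sum Ns (λ N → seq (δ P N) k ℚ.* g N)                 ≤⟨ sum-δ P g 0≤g u ⟩
    g P                                                  ∎
  ... | yes refl = begin
    1ℚ ℚ.* g P ℚ.+ sum Ns (λ N → seq (δ P N) k ℚ.* g N)  ≤⟨ ℚₚ.+-mono-≤ (ℚₚ.≤-reflexive (ℚₚ.*-identityˡ (g P))) (sum-mono Ns vanish) ⟩
    g P ℚ.+ sum Ns (λ _ → 0ℚ)                            ≡⟨ cong (g P ℚ.+_) (sum-0 Ns) ⟩
    g P ℚ.+ 0ℚ                                           ≡⟨ ℚₚ.+-identityʳ (g P) ⟩
    g P                                                  ∎
    where
    vanish : ∀ {N} → N ∈ Ns → seq (δ P N) k ℚ.* g N ℚ.≤ 0ℚ
    vanish {N} N∈ with P ≟ N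
    ... | yes refl = contradiction refl (All.lookup N∉ N∈)
    ... | no  _    = ℚₚ.≤-reflexive (ℚₚ.*-zeroˡ (g N))

  module _ (n : ℕ) where

    sum-ℙ-weight : ∀ {L Ns} → loLen (suc n) L ℕ.≤ n → Unique Ns →
      sum Ns (λ N → ∣ seq (ℙ ε L N) k ∣ ℚ.* weight n N) ℚ.≤ drift (seq ε k) ℚ.* weight n L
    -- Passing the list with an equation leaves `redexes L` intact inside `ℙ` and `weight`.
    sum-ℙ-weight {L} {Ns} ≤n u = cases (redexes L) refl
      where
      cases : ∀ Rs → redexes L ≡ Rs →
        sum Ns (λ N → ∣ seq (ℙ ε L N) k ∣ ℚ.* weight n N) ℚ.≤ drift (seq ε k) ℚ.* weight n L
      cases [] eq = begin
        sum Ns (λ N → ∣ seq (ℙ ε L N) k ∣ ℚ.* weight n N)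
          ≤⟨ sum-mono Ns (λ {N} _ → ℚₚ.≤-reflexive (trans
               (cong (λ p → ∣ p ∣ ℚ.* weight n N) (ℙ-normal {L} eq N)) (ℚₚ.*-zeroˡ (weight n N)))) ⟩
        sum Ns (λ _ → 0ℚ)
          ≡⟨ sum-0 Ns ⟩
        0ℚ
          ≤⟨ 0≤p*q (0≤drift (seq ε k)) (0≤weight n L) ⟩
        drift (seq ε k) ℚ.* weight n L ∎
      cases (r ∷ rs) eq = begin
        sum Ns (λ N → ∣ seq (ℙ ε L N) k ∣ ℚ.* weight n N)
          ≤⟨ sum-mono Ns (λ {N} _ → split N) ⟩
        sum Ns (λ N → ∣ e ∣ ℚ.* (seq (δ P N) k ℚ.* weight n N) ℚ.+ ∣ e′ ∣ ℚ.* (seq (δ Q N) k ℚ.* weight n N))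
          ≡⟨ trans (sum-+ Ns _ _) (cong₂ ℚ._+_ (sum-*ˡ Ns ∣ e ∣ _) (sum-*ˡ Ns ∣ e′ ∣ _)) ⟩
        ∣ e ∣ ℚ.* sum Ns (λ N → seq (δ P N) k ℚ.* weight n N) ℚ.+ ∣ e′ ∣ ℚ.* sum Ns (λ N → seq (δ Q N) k ℚ.* weight n N)
          ≤⟨ ℚₚ.+-mono-≤ (*-monoˡ (ℚₚ.0≤∣p∣ e) (sum-δ P (weight n) (0≤weight n) u))
                         (*-monoˡ (ℚₚ.0≤∣p∣ e′) (sum-δ Q (weight n) (0≤weight n) u)) ⟩
        ∣ e ∣ ℚ.* weight n P ℚ.+ ∣ e′ ∣ ℚ.* weight n Q
          ≤⟨ ℚₚ.+-mono-≤ (ℚₚ.≤-reflexive (cong (∣ e ∣ ℚ.*_) (weight-leftmost n {L} eq ≤n)))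
                         (*-monoˡ (ℚₚ.0≤∣p∣ e′) (weight-⇛ n (→β⇒⇛ (proj₂ (rightmost r rs))))) ⟩
        ∣ e ∣ ℚ.* (½ ℚ.* weight n L) ℚ.+ ∣ e′ ∣ ℚ.* weight n L
          ≡⟨ solve 3 (λ x y w → x :* (con ½ :* w) :+ y :* w := (con ½ :* x :+ y) :* w) refl ∣ e ∣ ∣ e′ ∣ (weight n L) ⟩
        drift (seq ε k) ℚ.* weight n L ∎
        where
        e  = seq ε k
        e′ = 1ℚ ℚ.- seq ε k
        P  = contract (leftmost r rs)
        Q  = contract (rightmost r rs)
        ∣*δ∣ : ∀ x M N → ∣ x ℚ.* seq (δ M N) k ∣ ≡ ∣ x ∣ ℚ.* seq (δ M N) k
        ∣*δ∣ x M N = trans (ℚₚ.∣p*q∣≡∣p∣*∣q∣ x (seq (δ M N) k)) (cong (∣ x ∣ ℚ.*_) (ℚₚ.0≤p⇒∣p∣≡p (0≤δ M N)))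
        split : ∀ N → ∣ seq (ℙ ε L N) k ∣ ℚ.* weight n N ℚ.≤
                ∣ e ∣ ℚ.* (seq (δ P N) k ℚ.* weight n N) ℚ.+ ∣ e′ ∣ ℚ.* (seq (δ Q N) k ℚ.* weight n N)
        split N = begin
          ∣ seq (ℙ ε L N) k ∣ ℚ.* weight n N
            ≡⟨ cong (λ p → ∣ p ∣ ℚ.* weight n N) (ℙ-reducible {L} eq N) ⟩
          ∣ e ℚ.* seq (δ P N) k ℚ.+ e′ ℚ.* seq (δ Q N) k ∣ ℚ.* weight n N
            ≤⟨ *-monoʳ (0≤weight n N) (ℚₚ.∣p+q∣≤∣p∣+∣q∣ (e ℚ.* seq (δ P N) k) (e′ ℚ.* seq (δ Q N) k)) ⟩
          (∣ e ℚ.* seq (δ P N) k ∣ ℚ.+ ∣ e′ ℚ.* seq (δ Q N) k ∣) ℚ.* weight n N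
            ≡⟨ cong₂ (λ x y → (x ℚ.+ y) ℚ.* weight n N) (∣*δ∣ e P N) (∣*δ∣ e′ Q N) ⟩
          (∣ e ∣ ℚ.* seq (δ P N) k ℚ.+ ∣ e′ ∣ ℚ.* seq (δ Q N) k) ℚ.* weight n N
            ≡⟨ solve 5 (λ a b x y w → (a :* x :+ b :* y) :* w := a :* (x :* w) :+ b :* (y :* w))
                 refl ∣ e ∣ ∣ e′ ∣ (seq (δ P N) k) (seq (δ Q N) k) (weight n N) ⟩
          ∣ e ∣ ℚ.* (seq (δ P N) k ℚ.* weight n N) ℚ.+ ∣ e′ ∣ ℚ.* (seq (δ Q N) k ℚ.* weight n N) ∎

    module _ {M : Λ} (M≤n : loLen (suc n) M ℕ.≤ n) where

      potential : ℕ → ℚ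
      potential i = sum (reachable M i) (λ N → ∣ seq (ρ ε M i N) k ∣ ℚ.* weight n N)

      potential-zero : potential 0 ≡ weight n M
      potential-zero with M ≟ M
      ... | yes _  = trans (ℚₚ.+-identityʳ _) (ℚₚ.*-identityˡ (weight n M))
      ... | no M≢M = contradiction refl M≢M

      -- After the triangle inequality and an exchange of sums, the one-step bound applies to each
      -- reachable `L`, whose leftmost reduction is no longer than that of `M`.
      potential-suc : ∀ i → potential (suc i) ℚ.≤ drift (seq ε k) ℚ.* potential i
      potential-suc i = begin
        sum Ns (λ N → ∣ seq (∑ Ls (λ L → ρ ε M i L Real.* ℙ ε L N)) k ∣ ℚ.* weight n N)
          ≤⟨ sum-mono Ns (λ {N} _ → split N) ⟩
        sum Ns (λ N → sum Ls (λ L → a L ℚ.* (p L N ℚ.* weight n N)))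
          ≡⟨ sum-swap Ns Ls (λ N L → a L ℚ.* (p L N ℚ.* weight n N)) ⟩
        sum Ls (λ L → sum Ns (λ N → a L ℚ.* (p L N ℚ.* weight n N)))
          ≤⟨ sum-mono Ls step ⟩
        sum Ls (λ L → drift (seq ε k) ℚ.* (a L ℚ.* weight n L))
          ≡⟨ sum-*ˡ Ls (drift (seq ε k)) _ ⟩
        drift (seq ε k) ℚ.* potential i ∎
        where
        Ls = reachable M i
        Ns = reachable M (suc i)
        a : Λ → ℚ
        a L = ∣ seq (ρ ε M i L) k ∣
        p : Λ → Λ → ℚ
        p L N = ∣ seq (ℙ ε L N) k ∣
        split : ∀ N → ∣ seq (∑ Ls (λ L → ρ ε M i L Real.* ℙ ε L N)) k ∣ ℚ.* weight n N
                      ℚ.≤ sum Ls (λ L → a L ℚ.* (p L N ℚ.* weight n N))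
        split N = begin
          ∣ seq (∑ Ls (λ L → ρ ε M i L Real.* ℙ ε L N)) k ∣ ℚ.* weight n N
            ≤⟨ *-monoʳ (0≤weight n N) (∣∑∣≤ Ls (λ L → ρ ε M i L Real.* ℙ ε L N) k) ⟩
          sum Ls (λ L → ∣ seq (ρ ε M i L) k ℚ.* seq (ℙ ε L N) k ∣) ℚ.* weight n N
            ≡⟨ trans (ℚₚ.*-comm _ (weight n N)) (sym (sum-*ˡ Ls (weight n N) _)) ⟩
          sum Ls (λ L → weight n N ℚ.* ∣ seq (ρ ε M i L) k ℚ.* seq (ℙ ε L N) k ∣)
            ≤⟨ sum-mono Ls (λ {L} _ → ℚₚ.≤-reflexive (trans
                 (cong (weight n N ℚ.*_) (ℚₚ.∣p*q∣≡∣p∣*∣q∣ (seq (ρ ε M i L) k) (seq (ℙ ε L N) k)))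
                 (solve 3 (λ w x y → w :* (x :* y) := x :* (y :* w)) refl (weight n N) (a L) (p L N)))) ⟩
          sum Ls (λ L → a L ℚ.* (p L N ℚ.* weight n N)) ∎
        step : ∀ {L} → L ∈ Ls → sum Ns (λ N → a L ℚ.* (p L N ℚ.* weight n N))
                                ℚ.≤ drift (seq ε k) ℚ.* (a L ℚ.* weight n L)
        step {L} L∈ = begin
          sum Ns (λ N → a L ℚ.* (p L N ℚ.* weight n N))
            ≡⟨ sum-*ˡ Ns (a L) _ ⟩
          a L ℚ.* sum Ns (λ N → p L N ℚ.* weight n N)
            ≤⟨ *-monoˡ (ℚₚ.0≤∣p∣ (seq (ρ ε M i L) k))
                 (sum-ℙ-weight (ℕₚ.≤-trans (loLen-⇛ (suc n) (reachable-⇛ i L∈)) M≤n) (reachable-unique M (suc i))) ⟩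
          a L ℚ.* (drift (seq ε k) ℚ.* weight n L)
            ≡⟨ solve 3 (λ x c w → x :* (c :* w) := c :* (x :* w)) refl (a L) (drift (seq ε k)) (weight n L) ⟩
          drift (seq ε k) ℚ.* (a L ℚ.* weight n L) ∎

      mass≤potential : ∀ i → ∣ seq (mass ε M i) k ∣ ℚ.≤ potential i
      mass≤potential i = ℚₚ.≤-trans (∣∑∣≤ (reachable M i) (ρ ε M i) k) (sum-mono (reachable M i) λ {N} _ →
        ≡.subst (ℚ._≤ ∣ seq (ρ ε M i N) k ∣ ℚ.* weight n N) (ℚₚ.*-identityʳ _)
          (*-monoˡ (ℚₚ.0≤∣p∣ (seq (ρ ε M i N) k)) (1≤weight n N)))

      potential-geometric : ∀ {q} → drift (seq ε k) ℚ.≤ q → ∀ i → potential i ℚ.≤ weight n M ℚ.* q ^ i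
      potential-geometric c≤q zero = ℚₚ.≤-reflexive (trans potential-zero (sym (ℚₚ.*-identityʳ (weight n M))))
      potential-geometric {q} c≤q (suc i) = begin
        potential (suc i)
          ≤⟨ potential-suc i ⟩
        drift (seq ε k) ℚ.* potential i
          ≤⟨ *-monoˡ (0≤drift (seq ε k)) (potential-geometric c≤q i) ⟩
        drift (seq ε k) ℚ.* (weight n M ℚ.* q ^ i)
          ≤⟨ *-monoʳ (0≤p*q (0≤weight n M) (0≤p^n i (ℚₚ.≤-trans (0≤drift (seq ε k)) c≤q))) c≤q ⟩
        q ℚ.* (weight n M ℚ.* q ^ i)
          ≡⟨ solve 3 (λ q w x → q :* (w :* x) := w :* (q :* x)) refl q (weight n M) (q ^ i) ⟩
        weight n M ℚ.* q ^ suc i ∎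

-- Bound on the contraction factor, and the conclusion.

-- The constants satisfy (1/2 + 1 + 1/10) (5/4) = 2, which handles e > 1.
drift≤ : ∀ {d e} → 0ℚ ℚ.≤ d → d ℚ.≤ e → e ℚ.≤ + 5 / 4 → drift e ℚ.≤ 1ℚ ℚ.- + 1 / 10 ℚ.* d
drift≤ {d} {e} 0≤d d≤e e≤5/4 = begin
  ½ ℚ.* ∣ e ∣ ℚ.+ ∣ 1ℚ ℚ.- e ∣           ≤⟨ ℚₚ.+-mono-≤ (ℚₚ.≤-reflexive (cong (½ ℚ.*_) (ℚₚ.0≤p⇒∣p∣≡p 0≤e)))
                                                         (∣p∣≤q {1ℚ ℚ.- e} below above) ⟩
  ½ ℚ.* e ℚ.+ (1ℚ ℚ.- t ℚ.- ½ ℚ.* e)     ≡⟨ solve 2 (λ x y → x :+ (y :- x) := y) refl (½ ℚ.* e) (1ℚ ℚ.- t) ⟩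
  1ℚ ℚ.- t                               ∎
  where
  t = + 1 / 10 ℚ.* d
  0≤e : 0ℚ ℚ.≤ e
  0≤e = ℚₚ.≤-trans 0≤d d≤e
  0≤e/10-t : 0ℚ ℚ.≤ + 1 / 10 ℚ.* e ℚ.- t
  0≤e/10-t = p≤q⇒0≤q-p (*-monoˡ (ℚₚ.nonNegative⁻¹ (+ 1 / 10)) d≤e)
  below : 1ℚ ℚ.- e ℚ.≤ 1ℚ ℚ.- t ℚ.- ½ ℚ.* e
  below = ≡.subst (1ℚ ℚ.- e ℚ.≤_)
    (solve 2 (λ e t → con 1ℚ :- e :+ (con (+ 2 / 5) :* e :+ (con (+ 1 / 10) :* e :- t))
                   := con 1ℚ :- t :- con ½ :* e) refl e t)
    (p≤p+q (1ℚ ℚ.- e) (ℚₚ.+-mono-≤ (0≤p*q (ℚₚ.nonNegative⁻¹ (+ 2 / 5)) 0≤e) 0≤e/10-t))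
  above : ℚ.- (1ℚ ℚ.- e) ℚ.≤ 1ℚ ℚ.- t ℚ.- ½ ℚ.* e
  above = ≡.subst (ℚ.- (1ℚ ℚ.- e) ℚ.≤_)
    (solve 2 (λ e t → :- (con 1ℚ :- e) :+ (con (+ 8 / 5) :* (con (+ 5 / 4) :- e) :+ (con (+ 1 / 10) :* e :- t))
                   := con 1ℚ :- t :- con ½ :* e) refl e t)
    (p≤p+q (ℚ.- (1ℚ ℚ.- e)) (ℚₚ.+-mono-≤ (0≤p*q (ℚₚ.nonNegative⁻¹ (+ 8 / 5)) (p≤q⇒0≤q-p e≤5/4)) 0≤e/10-t))

theorem4 : ∀ (ε : ℝ) → 0ℝ ≤ ε → ε ≤ 1ℝ → 0ℝ < ε → PAST ε
theorem4 ε 0≤ε ε≤1 (d , 0<d , N₁ , d≤ε) M wn =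
  geometric⇒HasSum (λ i → mass ε M (suc i)) {K = K} 0≤w 0<t t≤1 bound
  where
  n = proj₁ (weaklyNormalising⇒loLen wn)
  M≤n = proj₂ (weaklyNormalising⇒loLen wn)
  -- Any slack is available above 1; a quarter is what the bound on the drift tolerates.
  ε≤5/4 = ε≤1 (+ 1 / 4) (ℚₚ.positive⁻¹ (+ 1 / 4))
  N₂ = proj₁ ε≤5/4
  K = N₁ ℕ.⊔ N₂
  w = weight n M
  t = + 1 / 10 ℚ.* d
  r = 1ℚ ℚ.- t
  0≤w : 0ℚ ℚ.≤ w
  0≤w = 0≤weight n M
  0<t : 0ℚ ℚ.< t
  0<t = ≡.subst (ℚ._< t) (ℚₚ.*-zeroʳ (+ 1 / 10)) (ℚₚ.*-monoʳ-<-pos (+ 1 / 10) 0<d)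
  lower : ∀ k → K ℕ.≤ k → d ℚ.≤ seq ε k
  lower k K≤k = ≡.subst (ℚ._≤ seq ε k) (ℚₚ.+-identityˡ d) (d≤ε k (ℕₚ.m⊔n≤o⇒m≤o N₁ N₂ K≤k))
  upper : ∀ k → K ℕ.≤ k → seq ε k ℚ.≤ + 5 / 4
  upper k K≤k = proj₂ ε≤5/4 k (ℕₚ.m⊔n≤o⇒n≤o N₁ N₂ K≤k)
  t≤1 : t ℚ.≤ 1ℚ
  -- Late approximations of ε lie between d and 5/4, so t ≤ 1/8.
  t≤1 = begin
    t                         ≤⟨ *-monoˡ (ℚₚ.nonNegative⁻¹ (+ 1 / 10)) (ℚₚ.≤-trans (lower K ℕₚ.≤-refl) (upper K ℕₚ.≤-refl)) ⟩
    + 1 / 10 ℚ.* (+ 5 / 4)    ≤⟨ ℚₚ.≤ᵇ⇒≤ _ ⟩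
    1ℚ                        ∎
  bound : ∀ i k → K ℕ.≤ k → ∣ seq (mass ε M (suc i)) k ∣ ℚ.≤ w ℚ.* r ^ i
  bound i k K≤k = begin
    ∣ seq (mass ε M (suc i)) k ∣   ≤⟨ mass≤potential ε k n M≤n (suc i) ⟩
    potential ε k n M≤n (suc i)    ≤⟨ potential-geometric ε k n M≤n
                                        (drift≤ (ℚₚ.<⇒≤ 0<d) (lower k K≤k) (upper k K≤k)) (suc i) ⟩
    -- The series starts at index 1, so one spare factor r ≤ 1 is dropped.
    w ℚ.* (r ℚ.* r ^ i)            ≤⟨ *-monoˡ 0≤w (*-monoʳ (0≤p^n i (p≤q⇒0≤q-p t≤1)) (p-q≤p 1ℚ (ℚₚ.<⇒≤ 0<t))) ⟩
    w ℚ.* (1ℚ ℚ.* r ^ i)           ≡⟨ cong (w ℚ.*_) (ℚₚ.*-identityˡ (r ^ i)) ⟩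
    w ℚ.* r ^ i                    ∎
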